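{- Let $n>1$ be finite and let $\mathcal L_n$ be the logic corresponding to $\mathsf D_n$ or to $\mathsf G_n$. Then $\mathcal L_n$ has the omitting types theorem. In fact, if $T$ is a countable consistent $\mathcal L_n$ theory, then any family of fewer than $\mathrm{cov}K$ many non-principal types of $T$ can be omitted in a model of $T$ (of type $\mathsf D_n$, respectively $\mathsf G_n$) with countable base.
   Context: $\mathrm{cov}K$ is the least cardinal $\kappa$ such that the real line can be covered by $\kappa$ nowhere dense sets. $\mathsf D_n$ is the class of relativized set algebras with unit a set $V\subseteq{}^nM$ such that $s\in V$ implies $s\circ[i|j]\in V$ for all $i,j<n$ ($[i|j]$ sends $i$ to $j$ and fixes everything else); $\mathsf G_n$ is the class of those with unit $V$ such that $s\in V$ implies $s\circ\tau\in V$ for all $\tau:n\to n$. In such algebras $c_iX=\{s\in V:\exists t\in X,\ t_j=s_j\ \forall j\ne i\}$, $d_{ij}=\{s\in V:s_i=s_j\}$ (and for $\mathsf G_n$ also $s_\tau X=\{s\in V:s\circ\tau\in X\}$). The corresponding logic $\mathcal L_n$: formulas are built from $n$-ary relation symbols $R(x_0,\dots,x_{n-1})$ (for $\mathsf G_n$ also $R(x_{\tau(0)},\dots,x_{\tau(n-1)})$, $\tau:n\to n$) and equalities $x_i=x_j$ ($i,j<n$) by Boolean connectives and quantifiers $\exists x_i$, $i<n$. A model consists of a base $M$, a set $V\subseteq{}^nM$ that is a unit of the kind required for $\mathsf D_n$ (respectively $\mathsf G_n$) with $M=\bigcup_{s\in V}\mathrm{rng}(s)$, and an interpretation of each relation symbol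 as a subset of $V$. Satisfaction is defined only for $s\in V$ as usual, with quantifiers relativized to $V$: $s$ satisfies $\exists x_i\phi$ iff some $t\in V$ with $t_j=s_j$ for $j\ne i$ satisfies $\phi$; and $s$ satisfies $R(x_{\tau(0)},\dots,x_{\tau(n-1)})$ iff $s\circ\tau$ is in the interpretation of $R$. It is a model of $T$ if every $s\in V$ satisfies every formula of $T$. $T\models\phi$ means every model of $T$ has all $s\in V$ satisfying $\phi$; a formula $\psi$ is consistent with $T$ if not $T\models\neg\psi$. A type $\Gamma$ (set of formulas) is non-principal if there is no $\psi$ consistent with $T$ with $T\models\psi\to\gamma$ for all $\gamma\in\Gamma$. It is omitted in a model if no $s\in V$ satisfies all of $\Gamma$. $\mathcal L_n$ has the omitting types theorem if, for countable consistent $T$, any countable family of non-principal types can be omitted in a model of $T$. -}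

module Defs where

open import Level using (0ℓ)
open import Data.Fin.Base using (Fin)
open import Data.Nat.Base using (ℕ)
open import Data.Product using (Σ; ∃; ∃-syntax; _×_; proj₁; _,_)
open import Data.Rational.Base using (ℚ; _<_)
open import Data.Sum.Base using (_⊎_)
open import Data.Unit.Base using (⊤)
open import Data.Vec.Base using (Vec; lookup; map; allFin; _[_]≔_)
open import Function.Bundles using (_↣_; _⇔_)
open import Relation.Binary.Definitions using (_Respects_)
open import Relation.Binary.PropositionalEquality using (_≡_; _≢_)
open import Relation.Nullary.Negation.Core using (¬_)
open import Relation.Unary using (Pred)

-- Countable means finite or countably infinite.
Countable : Set → Set
Countable A = A ↣ ℕ

_≺_ : Set → Set → Set
I ≺ K = (I ↣ K) × ¬ (K ↣ I)

-- The real line: two-sided Dedekind cuts of rationals.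
record ℝ : Set₁ where
  field
    L U       : Pred ℚ 0ℓ
    L-inhab   : ∃[ q ] L q
    U-inhab   : ∃[ q ] U q
    L-rounded : ∀ q → L q ⇔ (∃[ r ] (q < r × L r))
    U-rounded : ∀ q → U q ⇔ (∃[ r ] (r < q × U r))
    disjoint  : ∀ q → ¬ (L q × U q)
    located   : ∀ q r → q < r → L q ⊎ U r

open ℝ

-- Equality of reals.
_≈_ : ℝ → ℝ → Set
x ≈ y = (∀ q → L x q ⇔ L y q) × (∀ q → U x q ⇔ U y q)

-- The open intervals with rational endpoints are a base of the topology.
_∈⟨_,_⟩ : ℝ → ℚ → ℚ → Set
x ∈⟨ a , b ⟩ = L x a × U x b

Closure : ∀ {ℓ} → Pred ℝ ℓ → Pred ℝ _
Closure N x = ∀ a b → x ∈⟨ a , b ⟩ → ∃[ y ] (y ∈⟨ a , b ⟩ × N y)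

Interior : ∀ {ℓ} → Pred ℝ ℓ → Pred ℝ _
Interior A x = ∃[ a ] ∃[ b ] (x ∈⟨ a , b ⟩ × (∀ y → y ∈⟨ a , b ⟩ → A y))

NowhereDense : Pred ℝ 0ℓ → Set₁
NowhereDense N = ∀ x → ¬ Interior (Closure N) x

-- A subset of the real line is a predicate compatible with equality of reals.
CoversLine : Set → Set₁
CoversLine K =
  Σ (K → Pred ℝ 0ℓ) λ N →
    ((∀ (k : K) → N k Respects _≈_)
    × (∀ (k : K) → NowhereDense (N k))
    × (∀ (x : ℝ) → ∃[ k ] N k x))

-- Cardinals are represented by sets of that cardinality, so this says that
-- the cardinality of K is cov K, the least one of a covering family.
IsCovK : Set → Set₁
IsCovK K = CoversLine K × (∀ (J : Set) → CoversLine J → K ↣ J)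

-- 𝔻 and 𝔾 stand for the classes Dₙ and Gₙ.
data Class : Set where
  𝔻 𝔾 : Class

-- Transformations n → n are kept as vectors, so that equality of formulas
-- and of assignments is extensional.
Transf : ℕ → Set
Transf n = Vec (Fin n) n

infixl 8 _⊙_
_⊙_ : ∀ {A : Set} {n} → Vec A n → Transf n → Vec A n
s ⊙ τ = map (lookup s) τ

[_∣_] : ∀ {n} → Fin n → Fin n → Transf n
[ i ∣ j ] = allFin _ [ i ]≔ j

IsUnit : Class → ∀ {n} {M : Set} → Pred (Vec M n) 0ℓ → Set
IsUnit 𝔻 V = ∀ s → V s → ∀ i j → V (s ⊙ [ i ∣ j ])
IsUnit 𝔾 V = ∀ s → V s → ∀ τ → V (s ⊙ τ)

-- The variable patterns allowed in atomic formulas: for 𝔻 only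
-- R(x₀,…,xₙ₋₁), for 𝔾 every R(x_τ(0),…,x_τ(n-1)).
Args : Class → ℕ → Set
Args 𝔻 n = ⊤
Args 𝔾 n = Transf n

select : ∀ C {n} {M : Set} → Args C n → Vec M n → Vec M n
select 𝔻 _ s = s
select 𝔾 τ s = s ⊙ τ

infix  9 _≐_
infix  8 ¬′_
infixr 7 _∧′_
infixr 6 _∨′_
infixr 5 _⇒′_

data Formula (C : Class) (n : ℕ) (Rel : Set) : Set where
  rel            : Rel → Args C n → Formula C n Rel
  _≐_            : Fin n → Fin n → Formula C n Rel
  ¬′_            : Formula C n Rel → Formula C n Rel
  _∧′_ _∨′_ _⇒′_ : Formula C n Rel → Formula C n Rel → Formula C n Rel
  ∃′             : Fin n → Formula C n Rel → Formula C n Rel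

-- The base is nonempty, as usual for models; since it is the union of the
-- ranges of the members of the unit, so is the unit.  Without this the empty
-- model would satisfy every theory and omit every type.
record Model (C : Class) (n : ℕ) (Rel : Set) : Set₁ where
  field
    Base       : Set
    nonempty   : Base
    V          : Pred (Vec Base n) 0ℓ
    isUnit     : IsUnit C V
    covered    : ∀ m → ∃[ s ] (V s × ∃[ i ] lookup s i ≡ m)
    interp     : Rel → Pred (Vec Base n) 0ℓ
    interp⊆V   : ∀ R s → interp R s → V s

  Assignment : Set
  Assignment = Σ (Vec Base n) V

open Model

module _ {C : Class} {n : ℕ} {Rel : Set} where

  Sat : (𝔐 : Model C n Rel) → Assignment 𝔐 → Formula C n Rel → Set
  Sat 𝔐 (s , _) (rel R a) = interp 𝔐 R (select C a s)
  Sat 𝔐 (s , _) (i ≐ j)   = lookup s i ≡ lookup s j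
  Sat 𝔐 s (¬′ φ)          = ¬ Sat 𝔐 s φ
  Sat 𝔐 s (φ ∧′ ψ)        = Sat 𝔐 s φ × Sat 𝔐 s ψ
  Sat 𝔐 s (φ ∨′ ψ)        = Sat 𝔐 s φ ⊎ Sat 𝔐 s ψ
  Sat 𝔐 s (φ ⇒′ ψ)        = Sat 𝔐 s φ → Sat 𝔐 s ψ
  Sat 𝔐 s (∃′ i φ)        =
    ∃[ t ] ((∀ j → j ≢ i → lookup (proj₁ t) j ≡ lookup (proj₁ s) j) × Sat 𝔐 t φ)

  IsModelOf : Pred (Formula C n Rel) 0ℓ → Model C n Rel → Set
  IsModelOf T 𝔐 = ∀ s φ → T φ → Sat 𝔐 s φ

  infix 4 _⊨_
  _⊨_ : Pred (Formula C n Rel) 0ℓ → Formula C n Rel → Set₁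
  T ⊨ φ = ∀ 𝔐 → IsModelOf T 𝔐 → ∀ s → Sat 𝔐 s φ

  Consistent : Pred (Formula C n Rel) 0ℓ → Set₁
  Consistent T = ¬ (∃[ φ ] (T ⊨ φ × T ⊨ ¬′ φ))

  ConsistentWith : Pred (Formula C n Rel) 0ℓ → Formula C n Rel → Set₁
  ConsistentWith T ψ = ¬ (T ⊨ ¬′ ψ)

  NonPrincipal : Pred (Formula C n Rel) 0ℓ → Pred (Formula C n Rel) 0ℓ → Set₁
  NonPrincipal T Γ =
    ¬ (∃[ ψ ] (ConsistentWith T ψ × (∀ γ → Γ γ → T ⊨ ψ ⇒′ γ)))

  Omits : Model C n Rel → Pred (Formula C n Rel) 0ℓ → Set
  Omits 𝔐 Γ = ¬ (∃[ s ] (∀ γ → Γ γ → Sat 𝔐 s γ))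

-- A countable theory is, as usual, a theory in a countable language; as a set
-- of formulas it is then countable too.
OmittingTypesTheorem : Class → ℕ → Set₁
OmittingTypesTheorem C n =
  ∀ (Rel : Set) → Countable Rel →
  ∀ (T : Pred (Formula C n Rel) 0ℓ) → Consistent T →
  ∀ (I : Set) → Countable I →
  ∀ (Γ : I → Pred (Formula C n Rel) 0ℓ) → (∀ i → NonPrincipal T (Γ i)) →
  ∃[ 𝔐 ] (IsModelOf T 𝔐 × (∀ i → Omits 𝔐 (Γ i)))

module Submission where

-- Why the theorem holds.
--
-- Combinatorics.  Call a set I guessable (Guess) if every family of functions
-- f i : ℕ → ℕ, i ∈ I, is met by a single x : ℕ → ℕ, in the sense that for each i
-- there is an n with x n = f i n.  Countable sets are guessable for trivial
-- reasons.  If I is smaller than cov K, then no I-indexed family of nowhere dense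
-- sets covers the line, and I is guessable again: cut every rational interval
-- (a , b) into disjoint pieces numbered by ℕ; for fixed f i, the reals that lie,
-- for no (a , b), in the piece of (a , b) that f i names form a nowhere dense set,
-- and a real outside all these sets says which x to take (Guess-noncovering).
--
-- Guessability implies that for a countable partial order and dense sets D i k,
-- i ∈ I, k ∈ ℕ, some descending sequence meets all of them (genericSequence).  The
-- argument is the one by which Bartoszyński describes cov of the meager ideal
-- through infinitely often equal functions.  Guessing on the rows of ℕ × ℕ gives
-- an x that equals each f i infinitely often, hence an increasing sequence b that
-- infinitely often outruns the growth demanded by i; at those stages the next step
-- wanted by i is coded by a finite table, and guessing several entries at a time
-- one hits the right table infinitely often.  The index set I × ℕ is reached
-- without any comparison of I × ℕ with I, so no well-ordering of I is needed.
-- Countable choices come for free, since excluded middle for types yields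
-- elements of nonempty types.
--
-- Logic.  Formulas that are satisfiable in models of T form the partial order.
-- A generic sequence gives a complete type (completeType), which omits I × ℕ many
-- given sets of formulas provided each can be avoided below each condition.  To
-- reach all points of a model, close the types Γ i under derived types: p omits the
-- set of all (∃xᵢψ and not ∃xᵢ(ψ and not γ)), γ ∈ Γ, for all ψ iff no condition in the
-- order of xᵢ-neighbours of p isolates Γ.  Derived types of avoidable types are
-- avoidable (avoidable-derived), so there is a good type, one that omits all
-- derived types, and each good type has, for every ∃xᵢφ in it, a good
-- xᵢ-neighbour containing φ (neighbour).
--
-- Good types are arranged in a tree whose branchings are the demands for a witness
-- and, for 𝔾, the permutations of the variables.  Each node σ gets an n-tuple: a step
-- along xᵢ replaces the i-th entry by a fresh element, unless the new type says
-- that xᵢ equals some other xₖ.  The tuples form the unit of the model.  The point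
-- is that the type of a node is determined by its tuple, and up to the quantifier
-- ∃xⱼ by the entries other than the j-th.  For this one compares
-- tuple σ ∘ τ and tuple σ′ ∘ τ′ for all substitutions τ, τ′ whose effect is
-- expressible by formulas: stepping back along steps whose fresh element does not
-- occur, both pairs can be reduced until the last fresh element of the node does
-- occur, and then the two nodes coincide (reduce, type-unique).  The truth lemma
-- follows, and with it the theorem.

open import Defs
open import Level using (0ℓ; Lift; lift; lower) renaming (suc to ℓsuc)
open import Axiom.ExcludedMiddle using (ExcludedMiddle)
open import Data.Nat.Base using (ℕ)
open import Relation.Unary using (Pred)
open import Data.Product using (Σ-syntax; ∃; ∃-syntax; _×_; proj₁; proj₂; _,_)
open import Data.Sum.Base using (_⊎_; inj₁; inj₂)
open import Data.Maybe.Base using (Maybe; just; nothing)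
open import Data.Empty using (⊥-elim)
open import Function.Base using (_∘_; id; case_of_)
open import Function.Bundles using (_↣_; mk↣; Injection)
open import Relation.Binary.PropositionalEquality
  using (_≡_; _≢_; refl; sym; trans; cong; cong₂; subst)
open import Relation.Nullary using (¬_; Dec; yes; no)
open import Relation.Nullary.Decidable using (True; toWitness; fromWitness; map′; decidable-stable; ¬?; _×-dec_)

-- Codings of countable sets by natural numbers.
module Coding where
  open import Data.Nat.Base
  open import Data.Nat.Properties
  open import Data.List.Base using (List; []; _∷_)
  open import Data.Vec.Base using (Vec; []; _∷_)
  open import Data.Fin.Base using (Fin; toℕ)
  open import Data.Fin.Properties using (toℕ-injective)
  open import Data.Integer.Base using (ℤ; +_; -[1+_])
  open import Data.Rational.Base using (ℚ; mkℚ)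

  code : ∀ {A : Set} → Countable A → A → ℕ
  code = Injection.to

  code-injective : ∀ {A : Set} (c : Countable A) {x y} → code c x ≡ code c y → x ≡ y
  code-injective = Injection.injective

  private
    -- From s * s + a with a ≤ s one recovers s as the integer square root.
    root-≮ : ∀ {s t a c} → a ≤ s → s * s + a ≡ t * t + c → ¬ s < t
    root-≮ {s} {t} {a} {c} a≤s eq s<t = <-irrefl eq (begin-strict
      s * s + a          ≤⟨ +-monoʳ-≤ (s * s) a≤s ⟩
      s * s + s          ≡⟨ +-comm (s * s) s ⟩
      s + s * s          ≡⟨ *-suc s s ⟨
      s * suc s          <⟨ *-monoˡ-< (suc s) (n<1+n s) ⟩
      suc s * suc s      ≤⟨ *-mono-≤ s<t s<t ⟩
      t * t              ≤⟨ m≤m+n (t * t) c ⟩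
      t * t + c          ∎)
      where open ≤-Reasoning

  abstract
    -- The pairing function (a , b) ↦ (a + b)² + a.
    pair : ℕ → ℕ → ℕ
    pair a b = (a + b) * (a + b) + a

    pair-injective : ∀ {a b c d} → pair a b ≡ pair c d → a ≡ c × b ≡ d
    pair-injective {a} {b} {c} {d} eq = a≡c , +-cancelˡ-≡ a b d
      (trans s≡t (cong (_+ d) (sym a≡c)))
      where
      s≡t : a + b ≡ c + d
      s≡t = ≤-antisym (≮⇒≥ (root-≮ (m≤m+n c d) (sym eq))) (≮⇒≥ (root-≮ (m≤m+n a b) eq))
      a≡c : a ≡ c
      a≡c = +-cancelˡ-≡ ((a + b) * (a + b)) a c
        (trans eq (cong (λ s → s * s + c) (sym s≡t)))

    m≤pair : ∀ m n → m ≤ pair m n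
    m≤pair m n = m≤n+m m _

  ℕ-countable : Countable ℕ
  ℕ-countable = mk↣ id

  ×-countable : ∀ {A B : Set} → Countable A → Countable B → Countable (A × B)
  ×-countable cA cB = mk↣ {to = λ (x , y) → pair (code cA x) (code cB y)} λ eq →
    let (p , q) = pair-injective eq in cong₂ _,_ (code-injective cA p) (code-injective cB q)

  ⊎-countable : ∀ {A B : Set} → Countable A → Countable B → Countable (A ⊎ B)
  ⊎-countable {A} {B} cA cB = mk↣ (λ {x} {y} → inj x y)
    where
    to : A ⊎ B → ℕ
    to (inj₁ x) = pair 0 (code cA x)
    to (inj₂ y) = pair 1 (code cB y)
    inj : ∀ x y → to x ≡ to y → x ≡ y
    inj (inj₁ x) (inj₁ y) eq = cong inj₁ (code-injective cA (proj₂ (pair-injective eq)))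
    inj (inj₁ x) (inj₂ y) eq with () ← proj₁ (pair-injective eq)
    inj (inj₂ x) (inj₁ y) eq with () ← proj₁ (pair-injective eq)
    inj (inj₂ x) (inj₂ y) eq = cong inj₂ (code-injective cB (proj₂ (pair-injective eq)))

  List-countable : ∀ {A : Set} → Countable A → Countable (List A)
  List-countable {A} c = mk↣ (λ {x} {y} → inj x y)
    where
    to : List A → ℕ
    to []       = 0
    to (x ∷ xs) = suc (pair (code c x) (to xs))
    inj : ∀ xs ys → to xs ≡ to ys → xs ≡ ys
    inj []       []       eq = refl
    inj (x ∷ xs) (y ∷ ys) eq =
      let (p , q) = pair-injective (suc-injective eq)
      in cong₂ _∷_ (code-injective c p) (inj xs ys q)

  Vec-countable : ∀ {A : Set} {n} → Countable A → Countable (Vec A n)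
  Vec-countable {A} c = mk↣ (λ {x} {y} → inj x y)
    where
    to : ∀ {n} → Vec A n → ℕ
    to []       = 0
    to (x ∷ xs) = pair (code c x) (to xs)
    inj : ∀ {n} (xs ys : Vec A n) → to xs ≡ to ys → xs ≡ ys
    inj []       []       eq = refl
    inj (x ∷ xs) (y ∷ ys) eq =
      let (p , q) = pair-injective eq in cong₂ _∷_ (code-injective c p) (inj xs ys q)

  Fin-countable : ∀ {n} → Countable (Fin n)
  Fin-countable = mk↣ toℕ-injective

  ↣-countable : ∀ {A B : Set} (f : A → B) → (∀ {x y} → f x ≡ f y → x ≡ y) →
                Countable B → Countable A
  ↣-countable f f-inj cB = mk↣ (f-inj ∘ code-injective cB)

  ℚ-countable : Countable ℚ
  ℚ-countable = ↣-countable f (λ {p} {q} → f-inj p q)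
    (×-countable (⊎-countable ℕ-countable ℕ-countable) ℕ-countable)
    where
    g : ℤ → ℕ ⊎ ℕ
    g (+ n)    = inj₁ n
    g -[1+ n ] = inj₂ n
    g-inj : ∀ x y → g x ≡ g y → x ≡ y
    g-inj (+ m)    (+ n)    refl = refl
    g-inj -[1+ m ] -[1+ n ] refl = refl
    f : ℚ → (ℕ ⊎ ℕ) × ℕ
    f (mkℚ p q _) = g p , q
    f-inj : ∀ p q → f p ≡ f q → p ≡ q
    f-inj (mkℚ p q _) (mkℚ p′ q′ _) eq with g-inj p p′ (cong proj₁ eq) | cong proj₂ eq
    ... | refl | refl = refl

  -- Binary trees with labels, into which the syntax is translated.
  data Tree : Set where
    leaf : ℕ → Tree
    branch : ℕ → Tree → Tree → Tree

  Tree-countable : Countable Tree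
  Tree-countable = mk↣ (λ {x} {y} → inj x y)
    where
    to : Tree → ℕ
    to (leaf k)     = pair 0 k
    to (branch k t u) = pair 1 (pair k (pair (to t) (to u)))
    inj : ∀ x y → to x ≡ to y → x ≡ y
    inj (leaf k) (leaf l) eq = cong leaf (proj₂ (pair-injective eq))
    inj (leaf k) (branch l t u) eq with () ← proj₁ (pair-injective eq)
    inj (branch k t u) (leaf l) eq with () ← proj₁ (pair-injective eq)
    inj (branch k t u) (branch l t′ u′) eq
      with refl , eq₁ ← pair-injective (proj₂ (pair-injective eq))
      with p , q ← pair-injective eq₁
      = cong₂ (branch k) (inj t t′ p) (inj u u′ q)

  Args-countable : ∀ C {n} → Countable (Args C n)
  Args-countable 𝔻 = mk↣ {to = λ _ → 0} (λ _ → refl)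
  Args-countable 𝔾 = Vec-countable Fin-countable

  Formula-countable : ∀ {C n} {Rel : Set} → Countable Rel → Countable (Formula C n Rel)
  Formula-countable {C} {n} {Rel} cR = ↣-countable enc (λ {x} {y} → inj x y) Tree-countable
    where
    enc : Formula C n Rel → Tree
    enc (rel R a) = branch 0 (leaf (code cR R)) (leaf (code (Args-countable C) a))
    enc (i ≐ j)   = branch 1 (leaf (toℕ i)) (leaf (toℕ j))
    -- The second subtree only fills the place.
    enc (¬′ φ)    = branch 2 (enc φ) (enc φ)
    enc (φ ∧′ ψ)  = branch 3 (enc φ) (enc ψ)
    enc (φ ∨′ ψ)  = branch 4 (enc φ) (enc ψ)
    enc (φ ⇒′ ψ)  = branch 5 (enc φ) (enc ψ)
    enc (∃′ i φ)  = branch 6 (leaf (toℕ i)) (enc φ)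
    leaf-inj : ∀ {k l} → leaf k ≡ leaf l → k ≡ l
    leaf-inj refl = refl
    parts : ∀ {k l t u t′ u′} → branch k t u ≡ branch l t′ u′ → t ≡ t′ × u ≡ u′
    parts refl = refl , refl
    inj : ∀ φ ψ → enc φ ≡ enc ψ → φ ≡ ψ
    inj (rel R a) (rel S b) eq = let (p , q) = parts eq in
      cong₂ rel (code-injective cR (leaf-inj p)) (code-injective (Args-countable C) (leaf-inj q))
    inj (i ≐ j) (k ≐ l) eq = let (p , q) = parts eq in
      cong₂ _≐_ (toℕ-injective (leaf-inj p)) (toℕ-injective (leaf-inj q))
    inj (¬′ φ) (¬′ ψ) eq = cong ¬′_ (inj φ ψ (proj₁ (parts eq)))
    inj (φ ∧′ ψ) (φ′ ∧′ ψ′) eq = let (p , q) = parts eq in cong₂ _∧′_ (inj φ φ′ p) (inj ψ ψ′ q)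
    inj (φ ∨′ ψ) (φ′ ∨′ ψ′) eq = let (p , q) = parts eq in cong₂ _∨′_ (inj φ φ′ p) (inj ψ ψ′ q)
    inj (φ ⇒′ ψ) (φ′ ⇒′ ψ′) eq = let (p , q) = parts eq in cong₂ _⇒′_ (inj φ φ′ p) (inj ψ ψ′ q)
    inj (∃′ i φ) (∃′ j ψ) eq = let (p , q) = parts eq in
      cong₂ ∃′ (toℕ-injective (leaf-inj p)) (inj φ ψ q)

-- Excluded middle for small types and for truth values.
module Classical (em : ExcludedMiddle (ℓsuc 0ℓ)) where

  em₀ : ∀ {P : Set} → Dec P
  em₀ {P} = map′ lower lift (em {Lift (ℓsuc 0ℓ) P})

  byContradiction : ∀ {P : Set} → ¬ ¬ P → P
  byContradiction = decidable-stable em₀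

  byContradiction₁ : ∀ {P : Set₁} → ¬ ¬ P → P
  byContradiction₁ = decidable-stable em

  -- A small type that is inhabited iff P is.  Types of formulas have to be small
  -- to interpret the relation symbols, but are defined by consequence in all models.
  ⌊_⌋ : Set₁ → Set
  ⌊ P ⌋ = True (em {P})

  ⌊⌋-intro : ∀ {P} → P → ⌊ P ⌋
  ⌊⌋-intro = fromWitness

  ⌊⌋-elim : ∀ {P} → ⌊ P ⌋ → P
  ⌊⌋-elim = toWitness

-- Guessable index sets and generic sequences.
module Guessing (em : ExcludedMiddle (ℓsuc 0ℓ)) where
  open Classical em
  open Coding
  open import Data.Nat.Base
  open import Data.Nat.Properties
  open import Data.List.Base using (List; []; _∷_; length; applyUpTo)
  import Data.List.Base as List
  open import Data.List.Membership.Propositional using (_∈_; _∉_)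
  open import Data.List.Membership.Propositional.Properties using (∈-applyUpTo⁺; ∈-applyUpTo⁻)
  open import Data.List.Relation.Unary.Any using (here; there; index)
  open import Data.List.Relation.Unary.Any.Properties using (lookup-index)
  open import Data.Fin.Base using (Fin; toℕ)
  open import Relation.Binary.Definitions using (tri<; tri≈; tri>)
  import Data.Fin.Properties as Finₚ

  -- I is guessable: every I-indexed family of functions is met by one function.
  Guess : Set → Set
  Guess I = ∀ (f : I → ℕ → ℕ) → Σ[ x ∈ (ℕ → ℕ) ] (∀ i → ∃[ n ] x n ≡ f i n)

  Guess-countable : ∀ {I} → Countable I → Guess I
  Guess-countable {I} c f = x , λ i → code c i , x≡ i
    where
    x : ℕ → ℕ
    x n with em₀ {∃[ i ] code c i ≡ n}
    ... | yes (i , _) = f i n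
    ... | no _        = 0
    x≡ : ∀ i → x (code c i) ≡ f i (code c i)
    x≡ i with em₀ {∃[ j ] code c j ≡ code c i}
    ... | yes (j , eq) = cong (λ k → f k (code c i)) (code-injective c eq)
    ... | no ¬∃        = ⊥-elim (¬∃ (i , refl))

  -- The argument 0 is reserved for the additional index.
  Guess-Maybe : ∀ {I} → Guess I → Guess (Maybe I)
  Guess-Maybe {I} G f with G (λ i n → f (just i) (suc n))
  ... | x , x≡ = x′ , λ { nothing → 0 , refl ; (just i) → let (n , eq) = x≡ i in suc n , eq }
    where
    x′ : ℕ → ℕ
    x′ zero    = f nothing 0
    x′ (suc n) = x n

  module _ {I : Set} (G : Guess I) where

    -- Guess separately on each row of ℕ, the k-th row being the set of all pair k n.
    guess-infinitelyOften : ∀ {Y : Set} → Countable Y → Y → ∀ (g : I → ℕ → Y) →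
                   Σ[ h ∈ (ℕ → Y) ] (∀ i k → ∃[ n ] (k ≤ n × h n ≡ g i n))
    guess-infinitelyOften {Y} c y₀ g = h , λ i k → let (n , eq) = proj₂ (rows k) i in
      pair k n , m≤pair k n , h≡ eq
      where
      rows : ∀ k → Σ[ x ∈ (ℕ → ℕ) ] (∀ i → ∃[ n ] x n ≡ code c (g i (pair k n)))
      rows k = G (λ i n → code c (g i (pair k n)))
      Entry : ℕ → Y → Set
      Entry N y = ∃[ k ] ∃[ n ] (pair k n ≡ N × code c y ≡ proj₁ (rows k) n)
      h : ℕ → Y
      h N with em₀ {∃[ y ] Entry N y}
      ... | yes (y , _) = y
      ... | no _        = y₀
      h≡ : ∀ {k n y} → proj₁ (rows k) n ≡ code c y → h (pair k n) ≡ y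
      h≡ {k} {n} {y} eq with em₀ {∃[ y ] Entry (pair k n) y}
      ... | no ¬∃ = ⊥-elim (¬∃ (y , k , n , refl , sym eq))
      ... | yes (y′ , k′ , n′ , p , eq′) with refl , refl ← pair-injective p =
        code-injective c (trans eq′ eq)

    -- Running maximum.
    max : (ℕ → ℕ) → ℕ → ℕ
    max f zero    = f 0
    max f (suc m) = max f m ⊔ f (suc m)

    ≤-max : ∀ f {k m} → k ≤ m → f k ≤ max f m
    ≤-max f {k} {zero}  z≤n = ≤-refl
    ≤-max f {k} {suc m} k≤sm with m≤n⇒m<n∨m≡n k≤sm
    ... | inj₁ k<sm = ≤-trans (≤-max f (s≤s⁻¹ k<sm)) (m≤m⊔n _ _)
    ... | inj₂ refl = m≤n⊔m (max f m) _

    max-lub : ∀ f {m b} → (∀ k → k ≤ m → f k ≤ b) → max f m ≤ b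
    max-lub f {zero}  ub = ub 0 z≤n
    max-lub f {suc m} ub =
      ⊔-lub (max-lub f λ k k≤m → ub k (≤-trans k≤m (n≤1+n m))) (ub (suc m) ≤-refl)

    -- A single sequence bₙ with g i bₙ ≤ bₙ₊₁ infinitely often, for every i.
    module _ (g : I → ℕ → ℕ) (g-mono : ∀ i {m n} → m ≤ n → g i m ≤ g i n) where

      -- Guessing g i ∘ g i instead of g i makes up for bₙ not being known in advance.
      private
        h : Σ[ h ∈ (ℕ → ℕ) ] (∀ i k → ∃[ n ] (k ≤ n × h n ≡ g i (g i n)))
        h = guess-infinitelyOften ℕ-countable 0 (λ i n → g i (g i n))

      bound : ℕ → ℕ → ℕ
      bound b₀ zero    = b₀
      bound b₀ (suc n) = suc (bound b₀ n ⊔ max (proj₁ h) (bound b₀ n))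

      bound-< : ∀ b₀ n → bound b₀ n < bound b₀ (suc n)
      bound-< b₀ n = s≤s (m≤m⊔n _ _)

      n≤bound : ∀ b₀ n → n ≤ bound b₀ n
      n≤bound b₀ zero    = z≤n
      n≤bound b₀ (suc n) = ≤-<-trans (n≤bound b₀ n) (bound-< b₀ n)

      -- The index n of the interval [bₙ , bₙ₊₁) that contains m; d is a bound for the search.
      locate : ∀ b₀ d k m → m < bound b₀ (d + k) → bound b₀ k ≤ m →
               ∃[ n ] (k ≤ n × bound b₀ n ≤ m × m < bound b₀ (suc n))
      locate b₀ zero    k m m< ≤m = ⊥-elim (<⇒≱ m< ≤m)
      locate b₀ (suc d) k m m< ≤m with m <? bound b₀ (suc k)
      ... | yes m<b = k , ≤-refl , ≤m , m<b
      ... | no  m≮b =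
        let (n , k<n , p) = locate b₀ d (suc k) m (subst (λ e → m < bound b₀ e) (sym (+-suc d k)) m<) (≮⇒≥ m≮b)
        in n , <⇒≤ k<n , p

      -- Some m in [bₙ , bₙ₊₁) has h m = g i (g i m).  If bₙ₊₁ < g i bₙ, then
      -- g i bₙ₊₁ ≤ g i (g i m) = h m ≤ bₙ₊₂.
      bound-dominates : ∀ b₀ i k → ∃[ n ] (k ≤ n × g i (bound b₀ n) ≤ bound b₀ (suc n))
      bound-dominates b₀ i k
        with m , b≤m , hm ← proj₂ h i (bound b₀ k)
        with n , k≤n , bn≤m , m<b ← locate b₀ (suc m) k m
               (≤-trans (s≤s (m≤m+n m k)) (n≤bound b₀ (suc m + k))) b≤m
        with ≤-total (g i (bound b₀ n)) (bound b₀ (suc n))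
      ... | inj₁ gb≤ = n , k≤n , gb≤
      ... | inj₂ b≤g = suc n , ≤-trans k≤n (n≤1+n n) , (begin
        g i (bound b₀ (suc n))          ≤⟨ g-mono i b≤g ⟩
        g i (g i (bound b₀ n))          ≤⟨ g-mono i (g-mono i bn≤m) ⟩
        g i (g i m)                     ≡⟨ hm ⟨
        proj₁ h m                       ≤⟨ ≤-max (proj₁ h) (<⇒≤ m<b) ⟩
        max (proj₁ h) (bound b₀ (suc n)) ≤⟨ m≤n⊔m (bound b₀ (suc n)) _ ⟩
        bound b₀ (suc n) ⊔ max (proj₁ h) (bound b₀ (suc n)) ≤⟨ n≤1+n _ ⟩
        bound b₀ (suc (suc n))          ∎)
        where open ≤-Reasoning

      abstract
        bounds : ∀ b₀ → Σ[ b ∈ (ℕ → ℕ) ]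
                 (b₀ ≤ b 0 × (∀ n → b n ≤ b (suc n)) × (∀ n → n ≤ b n) ×
                  (∀ i k → ∃[ n ] (k ≤ n × g i (b n) ≤ b (suc n))))
        bounds b₀ = bound b₀ , ≤-refl , (λ n → <⇒≤ (bound-< b₀ n)) , n≤bound b₀ , bound-dominates b₀

    -- A function that agrees with φ i infinitely often on the infinite set K i, for every i.
    -- The value guessed at n is a list of n + 1 entries (k , φ i k) with k ∈ K i.  At most n
    -- arguments have been used up before, so one entry can still be put into the graph.
    module _ {Y : Set} (cY : Countable Y) (y₀ : Y)
             (K : I → ℕ → Set) (K-unbounded : ∀ i k → ∃[ n ] (k ≤ n × K i n))
             (φ : I → ℕ → Y) where

      private
        next : I → ℕ → ℕ
        next i k = proj₁ (K-unbounded i k)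

        -- key i n 0 < key i n 1 < … are elements of K i that are ≥ n.
        key : I → ℕ → ℕ → ℕ
        key i n zero    = next i n
        key i n (suc j) = next i (suc (key i n j))

        key∈K : ∀ i n j → K i (key i n j)
        key∈K i n zero    = proj₂ (proj₂ (K-unbounded i n))
        key∈K i n (suc j) = proj₂ (proj₂ (K-unbounded i (suc (key i n j))))

        key-< : ∀ i n {j k} → j < k → key i n j < key i n k
        key-< i n {j} {suc k} j<sk with m≤n⇒m<n∨m≡n (s≤s⁻¹ j<sk)
        ... | inj₁ j<k  = <-trans (key-< i n j<k) (proj₁ (proj₂ (K-unbounded i _)))
        ... | inj₂ refl = proj₁ (proj₂ (K-unbounded i _))

        n≤key : ∀ i n j → n ≤ key i n j
        n≤key i n zero    = proj₁ (proj₂ (K-unbounded i n))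
        n≤key i n (suc j) = <⇒≤ (≤-<-trans (n≤key i n j) (key-< i n (n<1+n j)))

        entry : I → ℕ → ℕ → ℕ × Y
        entry i n j = key i n j , φ i (key i n j)

        h : Σ[ h ∈ (ℕ → List (ℕ × Y)) ] (∀ i k → ∃[ n ] (k ≤ n × h n ≡ applyUpTo (entry i n) (suc n)))
        h = guess-infinitelyOften (List-countable (×-countable ℕ-countable cY)) []
              (λ i n → applyUpTo (entry i n) (suc n))

        -- An entry of the n-th guess whose argument is not among us.
        Pick : List ℕ → ℕ → ℕ × Y → Set
        Pick us n (k , y) = (k , y) ∈ proj₁ h n × k ∉ us

        pick : List ℕ → ℕ → Maybe (ℕ × Y)
        pick us n with em₀ {∃ (Pick us n)}
        ... | yes (e , _) = just e
        ... | no _        = nothing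

        use : Maybe (ℕ × Y) → List ℕ → List ℕ
        use nothing        us = us
        use (just (k , _)) us = k ∷ us

        -- The arguments whose value has been fixed before stage n.
        used : ℕ → List ℕ
        used zero    = []
        used (suc n) = use (pick (used n) n) (used n)

        pick-sound : ∀ {us n e} → pick us n ≡ just e → Pick us n e
        pick-sound {us} {n} eq with em₀ {∃ (Pick us n)} | eq
        ... | yes (_ , p) | refl = p

        pick-complete : ∀ {us n} → ∃ (Pick us n) → ∃[ e ] (pick us n ≡ just e)
        pick-complete {us} {n} p with em₀ {∃ (Pick us n)}
        ... | yes (e , _) = e , refl
        ... | no ¬p       = ⊥-elim (¬p p)

        length-used : ∀ n → length (used n) ≤ n
        length-used zero    = z≤n
        length-used (suc n) with pick (used n) n
        ... | just _  = s≤s (length-used n)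
        ... | nothing = ≤-trans (length-used n) (n≤1+n n)

        -- At stage n, the value y is fixed at the argument k.
        Picked : ℕ → ℕ → Y → Set
        Picked n k y = pick (used n) n ≡ just (k , y)

        Picked⇒used : ∀ {n m k y} → Picked n k y → n < m → k ∈ used m
        Picked⇒used {n} {suc m} {k} p n<sm with m≤n⇒m<n∨m≡n (s≤s⁻¹ n<sm)
        ... | inj₁ n<m  = use-∈ (pick (used m) m) (Picked⇒used p n<m)
          where
          use-∈ : ∀ e {us} → k ∈ us → k ∈ use e us
          use-∈ nothing  k∈ = k∈
          use-∈ (just _) k∈ = there k∈
        ... | inj₂ refl = subst (λ e → k ∈ use e (used n)) (sym p) (here refl)

        Picked-unique : ∀ {n m k y y′} → Picked n k y → Picked m k y′ → y ≡ y′
        Picked-unique {n} {m} p q with <-cmp n m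
        ... | tri< n<m _ _ = ⊥-elim (proj₂ (pick-sound q) (Picked⇒used p n<m))
        ... | tri> _ _ m<n = ⊥-elim (proj₂ (pick-sound p) (Picked⇒used q m<n))
        ... | tri≈ _ refl _ with refl ← trans (sym p) q = refl

        -- By the pigeonhole principle.
        unused : ∀ i n us → length us ≤ n → ∃[ j ] (j ≤ n × key i n j ∉ us)
        unused i n us ≤n = byContradiction λ none →
          let all∈ : ∀ (j : Fin (suc n)) → key i n (toℕ j) ∈ us
              all∈ j = byContradiction λ k∉ → none (toℕ j , s≤s⁻¹ (Finₚ.toℕ<n j) , k∉)
              (a , b , a<b , eq) = Finₚ.pigeonhole (s≤s ≤n) (λ j → index (all∈ j))
          in <-irrefl (trans (lookup-index (all∈ a))
                             (trans (cong (List.lookup us) eq) (sym (lookup-index (all∈ b)))))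
                      (key-< i n a<b)

        x : ℕ → Y
        x k with em₀ {∃[ n ] ∃[ y ] Picked n k y}
        ... | yes (_ , y , _) = y
        ... | no _            = y₀

        x≡ : ∀ {n k y} → Picked n k y → x k ≡ y
        x≡ {n} {k} {y} p with em₀ {∃[ n ] ∃[ y ] Picked n k y}
        ... | yes (_ , _ , q) = Picked-unique q p
        ... | no ¬p           = ⊥-elim (¬p (n , y , p))

      abstract
        guess-on : Σ[ x ∈ (ℕ → Y) ] (∀ i k → ∃[ n ] (k ≤ n × K i n × x n ≡ φ i n))
        guess-on = x , correct
          where
          correct : ∀ i k → ∃[ n ] (k ≤ n × K i n × x n ≡ φ i n)
          correct i k
            with n , k≤n , hn ← proj₂ h i k
            with j , j≤n , k∉ ← unused i n (used n) (length-used n)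
            with (k′ , y) , p ← pick-complete {used n} {n}
                   (entry i n j , subst (entry i n j ∈_) (sym hn) (∈-applyUpTo⁺ (entry i n) (s≤s j≤n)) , k∉)
            with j′ , _ , eq ← ∈-applyUpTo⁻ (entry i n) (subst ((k′ , y) ∈_) hn (proj₁ (pick-sound p)))
            with refl ← eq
            = key i n j′ , ≤-trans k≤n (n≤key i n j′) , key∈K i n j′ , x≡ p

    -- Entry number c of a list, and c itself if there is none.
    entryAt : List ℕ → ℕ → ℕ
    entryAt []       c       = c
    entryAt (y ∷ ys) zero    = y
    entryAt (y ∷ ys) (suc c) = entryAt ys c

    entryAt-applyUpTo : ∀ f {m c} → c < m → entryAt (applyUpTo f m) c ≡ f c
    entryAt-applyUpTo f {suc m} {zero}  _   = refl
    entryAt-applyUpTo f {suc m} {suc c} c<m = entryAt-applyUpTo (f ∘ suc) (s≤s⁻¹ c<m)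

    -- Read x ≽ y as: y extends x.  The step e i n from x to an extension stands for meeting
    -- the dense sets of i with numbers up to n.  For every i, infinitely many steps of s are of
    -- the form e i n.
    genericSequence :
      ∀ {X : Set} → Countable X → ∀ (x₀ : X) (_≽_ : X → X → Set₁) → (∀ {x} → x ≽ x) →
      ∀ (e : I → ℕ → X → X) → (∀ i n x → x ≽ e i n x) →
      Σ[ s ∈ (ℕ → X) ] (s 0 ≡ x₀ × (∀ n → s n ≽ s (suc n)) × (∀ i k → ∃[ n ] (k ≤ n × s (suc n) ≡ e i n (s n))))
    genericSequence {X} cX x₀ _≽_ ≽-refl e e-≽ = s , refl , (λ n → move-≽ n (s n) em) , hits
      where
      decode : ℕ → X
      decode c with em₀ {∃[ x ] code cX x ≡ c}
      ... | yes (x , _) = x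
      ... | no _        = x₀
      decode∘code : ∀ x → decode (code cX x) ≡ x
      decode∘code x with em₀ {∃[ y ] code cX y ≡ code cX x}
      ... | yes (_ , eq) = code-injective cX eq
      ... | no ¬p        = ⊥-elim (¬p (x , refl))
      ē : I → ℕ → ℕ → ℕ
      ē i n c = code cX (e i n (decode c))
      -- A common bound of the codes reached in a step e i n, n ≤ m, from a code ≤ m.
      g : I → ℕ → ℕ
      g i m = max (λ n → max (ē i n) m) m
      ē≤g : ∀ i {n c m} → n ≤ m → c ≤ m → ē i n c ≤ g i m
      ē≤g i {n} {m = m} n≤m c≤m = ≤-trans (≤-max (ē i n) c≤m) (≤-max (λ n → max (ē i n) m) n≤m)
      g-mono : ∀ i {m n} → m ≤ n → g i m ≤ g i n
      g-mono i m≤n = max-lub _ λ k k≤m → max-lub _ λ c c≤m →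
        ē≤g i (≤-trans k≤m m≤n) (≤-trans c≤m m≤n)
      B : Σ[ b ∈ (ℕ → ℕ) ]
          (code cX x₀ ≤ b 0 × (∀ n → b n ≤ b (suc n)) × (∀ n → n ≤ b n) ×
           (∀ i k → ∃[ n ] (k ≤ n × g i (b n) ≤ b (suc n))))
      B = bounds g g-mono (code cX x₀)
      b : ℕ → ℕ
      b = proj₁ B
      -- The codes of e i n x for all x of code ≤ b n.
      table : I → ℕ → List ℕ
      table i n = applyUpTo (ē i n) (suc (b n))
      tables : Σ[ x ∈ (ℕ → List ℕ) ]
               (∀ i k → ∃[ n ] (k ≤ n × g i (b n) ≤ b (suc n) × x n ≡ table i n))
      tables = guess-on (List-countable ℕ-countable) [] (λ i n → g i (b n) ≤ b (suc n))
                 (proj₂ (proj₂ (proj₂ (proj₂ B)))) table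
      target : ℕ → X → X
      target n x = decode (entryAt (proj₁ tables n) (code cX x))
      -- A guessed table may propose nonsense; s follows it only if the result extends x and its
      -- code stays below the bound.
      Admissible : ℕ → X → Set₁
      Admissible n x = x ≽ target n x × Lift (ℓsuc 0ℓ) (code cX (target n x) ≤ b (suc n))
      move : ∀ n (x : X) → Dec (Admissible n x) → X
      move n x (yes _) = target n x
      move n x (no _)  = x
      move-≽ : ∀ n x d → x ≽ move n x d
      move-≽ n x (yes (p , _)) = p
      move-≽ n x (no _)        = ≽-refl
      move-≤ : ∀ n x d → code cX x ≤ b n → code cX (move n x d) ≤ b (suc n)
      move-≤ n x (yes (_ , lift p)) _ = p
      move-≤ n x (no _)             p = ≤-trans p (proj₁ (proj₂ (proj₂ B)) n)
      move-yes : ∀ n x d → Admissible n x → move n x d ≡ target n x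
      move-yes n x (yes _) a = refl
      move-yes n x (no ¬a) a = ⊥-elim (¬a a)
      s : ℕ → X
      s zero    = x₀
      s (suc n) = move n (s n) em
      s≤b : ∀ n → code cX (s n) ≤ b n
      s≤b zero    = proj₁ (proj₂ B)
      s≤b (suc n) = move-≤ n (s n) em (s≤b n)
      target≡ : ∀ {i n} → proj₁ tables n ≡ table i n → ∀ {x} → code cX x ≤ b n → target n x ≡ e i n x
      target≡ {i} {n} tn {x} x≤b =
        trans (cong (λ t → decode (entryAt t (code cX x))) tn)
          (trans (cong decode (entryAt-applyUpTo (ē i n) (s≤s x≤b)))
            (trans (decode∘code _) (cong (e i n) (decode∘code x))))
      e-≤ : ∀ {i n} → g i (b n) ≤ b (suc n) → ∀ {x} → code cX x ≤ b n → code cX (e i n x) ≤ b (suc n)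
      e-≤ {i} {n} good {x} x≤b = begin
        code cX (e i n x)   ≡⟨ cong (λ x → code cX (e i n x)) (decode∘code x) ⟨
        ē i n (code cX x)   ≤⟨ ē≤g i (proj₁ (proj₂ (proj₂ (proj₂ B))) n) x≤b ⟩
        g i (b n)           ≤⟨ good ⟩
        b (suc n)           ∎
        where open ≤-Reasoning
      move≡ : ∀ {i n} → g i (b n) ≤ b (suc n) → proj₁ tables n ≡ table i n →
              ∀ {x} d → code cX x ≤ b n → move n x d ≡ e i n x
      move≡ {i} {n} good tn {x} d x≤b = trans (move-yes n x d admissible) t≡
        where
        t≡ : target n x ≡ e i n x
        t≡ = target≡ tn x≤b
        admissible : Admissible n x
        admissible = subst (x ≽_) (sym t≡) (e-≽ i n x) ,
                     lift (subst (λ y → code cX y ≤ b (suc n)) (sym t≡) (e-≤ good x≤b))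
      hits : ∀ i k → ∃[ n ] (k ≤ n × s (suc n) ≡ e i n (s n))
      hits i k = let (n , k≤n , good , tn) = proj₂ tables i k in
        n , k≤n , move≡ good tn em (s≤b n)

-- Families of nowhere dense sets of reals that do not cover the line.
module RealLine (em : ExcludedMiddle (ℓsuc 0ℓ)) where
  open Classical em
  open Coding
  open Guessing em using (Guess)
  open import Data.Nat.Base as ℕ using (ℕ; zero; suc)
  import Data.Nat.Properties as ℕ
  open import Data.Rational.Base using (ℚ; _<_; _+_; -_; 0ℚ; 1ℚ)
  import Data.Rational.Properties as ℚ
  open import Relation.Binary.Definitions using (tri<; tri≈; tri>)
  open import Function.Bundles using (mk⇔; Equivalence)
  open Equivalence using (to; from)
  open ℝ

  L-down : ∀ x {p q} → p < q → L x q → L x p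
  L-down x {p} {q} p<q Lq = from (L-rounded x p) (q , p<q , Lq)

  U-up : ∀ x {p q} → p < q → U x p → U x q
  U-up x {p} {q} p<q Up = from (U-rounded x q) (p , p<q , Up)

  L<U : ∀ x {p q} → L x p → U x q → p < q
  L<U x {p} {q} Lp Uq with ℚ.<-cmp p q
  ... | tri< p<q _ _  = p<q
  ... | tri≈ _ refl _ = ⊥-elim (disjoint x p (Lp , Uq))
  ... | tri> _ _ q<p  = ⊥-elim (disjoint x q (L-down x q<p Lp , Uq))

  fromℚ : ℚ → ℝ
  fromℚ e = record
    { L         = _< e
    ; U         = e <_
    ; L-inhab   = e + - 1ℚ , subst (e + - 1ℚ <_) (ℚ.+-identityʳ e)
        (ℚ.+-monoʳ-< e (toWitness {a? = - 1ℚ ℚ.<? 0ℚ} _))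
    ; U-inhab   = e + 1ℚ , subst (_< e + 1ℚ) (ℚ.+-identityʳ e)
        (ℚ.+-monoʳ-< e (toWitness {a? = 0ℚ ℚ.<? 1ℚ} _))
    ; L-rounded = λ q → mk⇔ ℚ.<-dense (λ (_ , q<r , r<e) → ℚ.<-trans q<r r<e)
    ; U-rounded = λ q → mk⇔ (λ e<q → let (r , e<r , r<q) = ℚ.<-dense e<q in r , r<q , e<r)
                            (λ (_ , r<q , e<r) → ℚ.<-trans e<r r<q)
    ; disjoint  = λ _ (q<e , e<q) → ℚ.<-asym q<e e<q
    ; located   = locate
    }
    where
    locate : ∀ q r → q < r → q < e ⊎ e < r
    locate q r q<r with ℚ.<-cmp q e
    ... | tri< q<e _ _  = inj₁ q<e
    ... | tri≈ _ refl _ = inj₂ q<r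
    ... | tri> _ _ e<q  = inj₂ (ℚ.<-trans e<q q<r)

  module _ {a b : ℚ} (a<b : a < b) where

    -- An increasing sequence of rationals in [a , b).
    cut< : ℕ → Σ[ c ∈ ℚ ] c < b
    cut< zero    = a , a<b
    cut< (suc m) = let (d , _ , d<b) = ℚ.<-dense (proj₂ (cut< m)) in d , d<b

    cut : ℕ → ℚ
    cut m = proj₁ (cut< m)

    cut-step : ∀ m → cut m < cut (suc m)
    cut-step m = proj₁ (proj₂ (ℚ.<-dense (proj₂ (cut< m))))

    -- The m-th of countably many disjoint subintervals of (a , b).
    Piece : ℕ → ℝ → Set
    Piece m x = x ∈⟨ cut m , cut (suc m) ⟩

    L-cut : ∀ x {m n} → m ℕ.≤ n → L x (cut n) → L x (cut m)
    L-cut x {m} {n} m≤n Lx with ℕ.m≤n⇒m<n∨m≡n m≤n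
    ... | inj₂ refl = Lx
    L-cut x {m} {suc n} _ Lx | inj₁ m<sn = L-cut x (ℕ.s≤s⁻¹ m<sn) (L-down x (cut-step n) Lx)

    piece-unique : ∀ x {m n} → Piece m x → Piece n x → m ≡ n
    piece-unique x {m} {n} (Lm , Um) (Ln , Un) with ℕ.<-cmp m n
    ... | tri< m<n _ _ = ⊥-elim (disjoint x _ (L-cut x m<n Ln , Um))
    ... | tri≈ _ eq _  = eq
    ... | tri> _ _ n<m = ⊥-elim (disjoint x _ (L-cut x n<m Lm , Un))

    piece⊆ : ∀ x m → Piece m x → x ∈⟨ a , b ⟩
    piece⊆ x m (Lx , Ux) = L-cut x {0} {m} ℕ.z≤n Lx , U-up x (proj₂ (cut< (suc m))) Ux

  interval-code : Countable (ℚ × ℚ)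
  interval-code = ×-countable ℚ-countable ℚ-countable

  -- The reals that lie in piece number f (a , b) of no interval (a , b).
  Avoids : (ℕ → ℕ) → Pred ℝ 0ℓ
  Avoids f x = ∀ a b (a<b : a < b) → ¬ Piece a<b (f (code interval-code (a , b))) x

  Avoids-nowhereDense : ∀ f → NowhereDense (Avoids f)
  Avoids-nowhereDense f x (a , b , (La , Ub) , ab⊆closure) =
    let m                 = f (code interval-code (a , b))
        a<b               = L<U x La Ub
        (e , c<e , e<d)   = ℚ.<-dense (cut-step a<b m)
        y                 = fromℚ e
        (z , z∈ , avoids) = ab⊆closure y (piece⊆ a<b y m (c<e , e<d)) (cut a<b m) (cut a<b (suc m)) (c<e , e<d)
    in avoids a b a<b z∈

  Guess-noncovering : ∀ {I} → ¬ CoversLine I → Guess I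
  Guess-noncovering {I} ¬covers f = guess , guess≡
    where
    uncovered : ∃[ x ] (∀ i → ¬ Avoids (f i) x)
    uncovered = byContradiction₁ λ none → ¬covers
      ( (λ i → Avoids (f i))
      , (λ i (L⇔ , U⇔) av a b a<b (Lx , Ux) → av a b a<b (from (L⇔ _) Lx , from (U⇔ _) Ux))
      , (λ i → Avoids-nowhereDense (f i))
      , (λ x → byContradiction λ ¬∃ → none (x , λ i av → ¬∃ (i , av))) )
    x = proj₁ uncovered
    InPiece : ℕ → ℕ → Set
    InPiece N m = ∃[ a ] ∃[ b ] (code interval-code (a , b) ≡ N × Σ[ a<b ∈ a < b ] Piece a<b m x)
    guess : ℕ → ℕ
    guess N with em₀ {∃ (InPiece N)}
    ... | yes (m , _) = m
    ... | no _        = 0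
    guess-unique : ∀ {N m} → InPiece N m → guess N ≡ m
    guess-unique {N} {m} (a , b , eq , a<b , p) with em₀ {∃ (InPiece N)}
    ... | no ¬∃ = ⊥-elim (¬∃ (m , a , b , eq , a<b , p))
    ... | yes (m′ , a′ , b′ , eq′ , a<b′ , p′)
      with refl ← code-injective interval-code {a′ , b′} {a , b} (trans eq′ (sym eq)) =
      piece-unique a<b x (subst (λ l → Piece l m′ x) (ℚ.<-irrelevant a<b′ a<b) p′) p
    guess≡ : ∀ i → ∃[ n ] guess n ≡ f i n
    guess≡ i = byContradiction λ none → proj₂ uncovered i λ a b a<b p →
      none (code interval-code (a , b) , guess-unique (a , b , refl , a<b , p))

-- Transformations of a finite set, acting on tuples.
module Transformations where
  open import Data.Nat.Base using (ℕ; zero; suc; _+_; _<_; s≤s; s≤s⁻¹)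
  import Data.Nat.Properties as ℕ
  open import Data.Fin.Base using (Fin; zero; suc; toℕ; fromℕ<; punchOut)
  open import Data.Fin.Properties using (_≟_; any?; toℕ-injective; toℕ<n; toℕ-fromℕ<;
    injective⇒≤; punchOut-injective)
  open import Data.Vec.Base using (Vec; lookup; tabulate; allFin; _[_]≔_)
  open import Data.Vec.Properties
    using (lookup-map; lookup∘tabulate; tabulate∘lookup; tabulate-cong; lookup-allFin;
           lookup∘update; lookup∘update′; map-lookup-allFin)

  vec-ext : ∀ {A : Set} {n} {s t : Vec A n} → (∀ k → lookup s k ≡ lookup t k) → s ≡ t
  vec-ext {s = s} {t} eq = trans (sym (tabulate∘lookup s)) (trans (tabulate-cong eq) (tabulate∘lookup t))

  lookup-⊙ : ∀ {A : Set} {n} (s : Vec A n) (τ : Transf n) k → lookup (s ⊙ τ) k ≡ lookup s (lookup τ k)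
  lookup-⊙ s τ k = lookup-map k (lookup s) τ

  ⊙-assoc : ∀ {A : Set} {n} (s : Vec A n) (τ ρ : Transf n) → s ⊙ τ ⊙ ρ ≡ s ⊙ (τ ⊙ ρ)
  ⊙-assoc s τ ρ = vec-ext λ k → trans (lookup-⊙ (s ⊙ τ) ρ k) (trans (lookup-⊙ s τ (lookup ρ k))
    (sym (trans (lookup-⊙ s (τ ⊙ ρ) k) (cong (lookup s) (lookup-⊙ τ ρ k)))))

  ⊙-allFin : ∀ {A : Set} {n} (s : Vec A n) → s ⊙ allFin n ≡ s
  ⊙-allFin = map-lookup-allFin

  lookup-[∣]-≡ : ∀ {n} (i j : Fin n) → lookup [ i ∣ j ] i ≡ j
  lookup-[∣]-≡ {n} i j = lookup∘update i (allFin n) j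

  lookup-[∣]-≢ : ∀ {n} (i j : Fin n) {k} → k ≢ i → lookup [ i ∣ j ] k ≡ k
  lookup-[∣]-≢ {n} i j {k} k≢i = trans (lookup∘update′ k≢i (allFin n) j) (lookup-allFin k)

  lookup-⊙[∣]-≡ : ∀ {A : Set} {n} (s : Vec A n) i j → lookup (s ⊙ [ i ∣ j ]) i ≡ lookup s j
  lookup-⊙[∣]-≡ s i j = trans (lookup-⊙ s [ i ∣ j ] i) (cong (lookup s) (lookup-[∣]-≡ i j))

  lookup-⊙[∣]-≢ : ∀ {A : Set} {n} (s : Vec A n) i j {k} → k ≢ i → lookup (s ⊙ [ i ∣ j ]) k ≡ lookup s k
  lookup-⊙[∣]-≢ s i j {k} k≢i = trans (lookup-⊙ s [ i ∣ j ] k) (cong (lookup s) (lookup-[∣]-≢ i j k≢i))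

  -- s and t agree except possibly at i.
  infix 4 _∼[_]_
  _∼[_]_ : ∀ {A : Set} {n} → Vec A n → Fin n → Vec A n → Set
  s ∼[ i ] t = ∀ j → j ≢ i → lookup s j ≡ lookup t j

  unit-[∣] : ∀ (D : Class) {n} {M : Set} {V : Pred (Vec M n) 0ℓ} → IsUnit D V →
             ∀ i j {s} → V s → V (s ⊙ [ i ∣ j ])
  unit-[∣] 𝔻 unit i j {s} Vs = unit s Vs i j
  unit-[∣] 𝔾 unit i j {s} Vs = unit s Vs [ i ∣ j ]

  replaced : ∀ {A : Set} {n} {s t : Vec A n} {i j} → i ≢ j →
             t ∼[ i ] s → lookup t i ≡ lookup t j → t ≡ s ⊙ [ i ∣ j ]
  replaced {s = s} {t} {i} {j} i≢j t∼s tᵢ≡tⱼ = vec-ext λ k → pointwise k (k ≟ i)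
    where
    pointwise : ∀ k → Dec (k ≡ i) → lookup t k ≡ lookup (s ⊙ [ i ∣ j ]) k
    pointwise k (yes refl) =
      trans tᵢ≡tⱼ (trans (t∼s j (i≢j ∘ sym)) (sym (lookup-⊙[∣]-≡ s i j)))
    pointwise k (no k≢i)   = trans (t∼s k k≢i) (sym (lookup-⊙[∣]-≢ s i j k≢i))

  [∣]-∼ : ∀ {A : Set} {n} (s : Vec A n) i j → s ⊙ [ i ∣ j ] ∼[ i ] s
  [∣]-∼ s i j k k≢i = lookup-⊙[∣]-≢ s i j k≢i

  [∣]-≡ : ∀ {A : Set} {n} (s : Vec A n) {i j} → i ≢ j →
          lookup (s ⊙ [ i ∣ j ]) i ≡ lookup (s ⊙ [ i ∣ j ]) j
  [∣]-≡ s {i} {j} i≢j = trans (lookup-⊙[∣]-≡ s i j) (sym (lookup-⊙[∣]-≢ s i j (i≢j ∘ sym)))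

  toUnit : ∀ D {n} {M : Set} {V : Pred (Vec M n) 0ℓ} →
           (∀ i j s → V s → V (s ⊙ [ i ∣ j ])) → (D ≡ 𝔾 → ∀ τ s → V s → V (s ⊙ τ)) → IsUnit D V
  toUnit 𝔻 r _ s Vs i j = r i j s Vs
  toUnit 𝔾 _ t s Vs τ   = t refl τ s Vs

  another : ∀ {n} → 1 < n → ∀ (j : Fin n) → ∃[ k ] j ≢ k
  another {suc zero}    (s≤s ()) _
  another {suc (suc _)} _ zero    = suc zero , λ ()
  another {suc (suc _)} _ (suc _) = zero , λ ()

  injective⇒surjective : ∀ {n} (f : Fin n → Fin n) → (∀ {a b} → f a ≡ f b → a ≡ b) →
                         ∀ m → ∃[ k ] f k ≡ m
  injective⇒surjective {suc n} f f-inj m with any? (λ k → f k ≟ m)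
  ... | yes hit  = hit
  ... | no  miss = ⊥-elim (ℕ.<-irrefl refl (injective⇒≤ {f = λ k → punchOut (m≢f k)}
                     (λ eq → f-inj (punchOut-injective (m≢f _) (m≢f _) eq))))
    where
    m≢f : ∀ k → m ≢ f k
    m≢f k eq = miss (k , sym eq)

  -- π and ρ are mutually inverse permutations.
  Inverse : ∀ {n} → Transf n → Transf n → Set
  Inverse {n} π ρ = π ⊙ ρ ≡ allFin n × ρ ⊙ π ≡ allFin n

  lookup-inverse : ∀ {n} {π ρ : Transf n} → π ⊙ ρ ≡ allFin n → ∀ k → lookup π (lookup ρ k) ≡ k
  lookup-inverse {n} {π} {ρ} eq k =
    trans (sym (lookup-⊙ π ρ k)) (trans (cong (λ v → lookup v k) eq) (lookup-allFin k))

  injective⇒inverse : ∀ {n} (π : Transf n) → (∀ a b → lookup π a ≡ lookup π b → a ≡ b) → ∃ (Inverse π)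
  injective⇒inverse {n} π inj = ρ ,
    (vec-ext λ k → trans (lookup-⊙ π ρ k) (trans (πρ k) (sym (lookup-allFin k)))) ,
    (vec-ext λ k → trans (lookup-⊙ ρ π k) (trans (inj _ _ (πρ (lookup π k))) (sym (lookup-allFin k))))
    where
    hit : ∀ m → ∃[ k ] lookup π k ≡ m
    hit = injective⇒surjective (lookup π) (inj _ _)
    ρ : Transf n
    ρ = tabulate (proj₁ ∘ hit)
    πρ : ∀ k → lookup π (lookup ρ k) ≡ k
    πρ k = trans (cong (lookup π) (lookup∘tabulate (proj₁ ∘ hit) k)) (proj₂ (hit k))

  noninjective⇒missed : ∀ {n} (τ : Transf n) {a b} → lookup τ a ≡ lookup τ b → a ≢ b →
                        ∃[ m ] (∀ k → lookup τ k ≢ m)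
  noninjective⇒missed {n} τ {a} {b} τa≡τb a≢b with any? (λ m → ¬? (any? λ k → lookup τ k ≟ m))
  ... | yes (m , miss) = m , λ k eq → miss (k , eq)
  ... | no  none = ⊥-elim (a≢b (trans (sym (σ-onto a)) (trans (cong σ τa≡τb) (σ-onto b))))
    where
    hit : ∀ m → ∃[ k ] lookup τ k ≡ m
    hit m = decidable-stable (any? λ k → lookup τ k ≟ m) (λ miss → none (m , miss))
    -- A section of τ is injective, hence onto, hence inverse to τ.
    σ : Fin n → Fin n
    σ = proj₁ ∘ hit
    σ-inj : ∀ {c d} → σ c ≡ σ d → c ≡ d
    σ-inj {c} {d} eq = trans (sym (proj₂ (hit c))) (trans (cong (lookup τ) eq) (proj₂ (hit d)))
    σ-onto : ∀ k → σ (lookup τ k) ≡ k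
    σ-onto k = let (m , eq) = injective⇒surjective σ σ-inj k in
      trans (cong (σ ∘ lookup τ) (sym eq)) (trans (cong σ (proj₂ (hit m))) eq)

  -- Every transformation arises from a permutation by replacements [ a ∣ b ].
  transf-induction : ∀ {ℓ n} (Q : Transf n → Set ℓ) →
    (∀ π ρ → Inverse π ρ → Q π) →
    (∀ τ a b → Q τ → Q (τ ⊙ [ a ∣ b ])) →
    ∀ τ → Q τ
  transf-induction {n = n} Q Q-perm Q-rep τ = go n 0 (ℕ.+-identityʳ n) τ λ _ _ ()
    where
    InjectiveBelow : ℕ → Transf n → Set
    InjectiveBelow k τ = ∀ a b → toℕ a < k → toℕ b < k → lookup τ a ≡ lookup τ b → a ≡ b
    extend : ∀ {k τ} a → toℕ a ≡ k → InjectiveBelow k τ →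
             (∀ b → toℕ b < k → lookup τ b ≢ lookup τ a) → InjectiveBelow (suc k) τ
    extend {k} {τ} a refl inj new c d c< d< eq
      with ℕ.m≤n⇒m<n∨m≡n (s≤s⁻¹ c<) | ℕ.m≤n⇒m<n∨m≡n (s≤s⁻¹ d<)
    ... | inj₁ c<a | inj₁ d<a = inj c d c<a d<a eq
    ... | inj₂ c≡a | inj₂ d≡a = toℕ-injective (trans c≡a (sym d≡a))
    ... | inj₁ c<a | inj₂ d≡a = ⊥-elim (new c c<a (trans eq (cong (lookup τ) (toℕ-injective d≡a))))
    ... | inj₂ c≡a | inj₁ d<a = ⊥-elim (new d d<a (trans (sym eq) (cong (lookup τ) (toℕ-injective c≡a))))
    -- If τ k = τ b with b < k, then τ = ρ ∘ [ k ∣ b ], where ρ sends k to a value missed by τ.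
    -- This ρ is injective on one more argument.
    go : ∀ d k → d + k ≡ n → ∀ τ → InjectiveBelow k τ → Q τ
    go zero k refl τ inj = let (ρ , inv) = injective⇒inverse τ (λ a b → inj a b (toℕ<n a) (toℕ<n b)) in
      Q-perm τ ρ inv
    go (suc d) k d+k≡n τ inj = step (any? λ b → dec b)
      where
      k<n : k < n
      k<n = subst (k <_) d+k≡n (s≤s (ℕ.m≤n+m k d))
      a : Fin n
      a = fromℕ< k<n
      a≡k : toℕ a ≡ k
      a≡k = toℕ-fromℕ< k<n
      dec : ∀ b → Dec (toℕ b < k × lookup τ b ≡ lookup τ a)
      dec b = (toℕ b ℕ.<? k) ×-dec (lookup τ b ≟ lookup τ a)
      next : d + suc k ≡ n
      next = trans (ℕ.+-suc d k) d+k≡n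
      step : Dec (∃[ b ] (toℕ b < k × lookup τ b ≡ lookup τ a)) → Q τ
      step (no none) = go d (suc k) next τ (extend {τ = τ} a a≡k inj λ b b<k eq → none (b , b<k , eq))
      step (yes (b , b<k , τb≡τa)) = subst Q τ≡ (Q-rep ρ a b (go d (suc k) next ρ ρ-inj))
        where
        b≢a : b ≢ a
        b≢a b≡a = ℕ.<-irrefl (trans (cong toℕ b≡a) a≡k) b<k
        missed : ∃[ m ] (∀ c → lookup τ c ≢ m)
        missed = noninjective⇒missed τ τb≡τa b≢a
        m : Fin n
        m = proj₁ missed
        ρ : Transf n
        ρ = τ [ a ]≔ m
        ρa : lookup ρ a ≡ m
        ρa = lookup∘update a τ m
        ρ≢ : ∀ {c} → c ≢ a → lookup ρ c ≡ lookup τ c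
        ρ≢ c≢a = lookup∘update′ c≢a τ m
        below : ∀ {c} → toℕ c < k → c ≢ a
        below c<k c≡a = ℕ.<-irrefl (trans (cong toℕ c≡a) a≡k) c<k
        ρ-inj : InjectiveBelow (suc k) ρ
        ρ-inj = extend {τ = ρ} a a≡k
          (λ c d c< d< eq → inj c d c< d< (trans (sym (ρ≢ (below c<))) (trans eq (ρ≢ (below d<)))))
          (λ c c< eq → proj₂ missed c (trans (sym (ρ≢ (below c<))) (trans eq ρa)))
        τ≡ : ρ ⊙ [ a ∣ b ] ≡ τ
        τ≡ = vec-ext λ c → pointwise c (c ≟ a)
          where
          pointwise : ∀ c → Dec (c ≡ a) → lookup (ρ ⊙ [ a ∣ b ]) c ≡ lookup τ c
          pointwise c (yes refl) = trans (lookup-⊙[∣]-≡ ρ a b) (trans (ρ≢ b≢a) τb≡τa)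
          pointwise c (no c≢a)   = trans (lookup-⊙[∣]-≢ ρ a b c≢a) (ρ≢ c≢a)

-- Permutations of the variables of a formula.
module Permutations {n : ℕ} where
  open Transformations
  open import Data.Vec.Base using (lookup)
  open Model

  module _ {Rel : Set} (π : Transf n) where
    -- φ with its variables renamed by the permutation π: it holds at s iff φ holds at s ∘ π.
    permute : Formula 𝔾 n Rel → Formula 𝔾 n Rel
    permute (rel R a) = rel R (π ⊙ a)
    permute (i ≐ j)   = lookup π i ≐ lookup π j
    permute (¬′ φ)    = ¬′ permute φ
    permute (φ ∧′ ψ)  = permute φ ∧′ permute ψ
    permute (φ ∨′ ψ)  = permute φ ∨′ permute ψ
    permute (φ ⇒′ ψ)  = permute φ ⇒′ permute ψ
    permute (∃′ i φ)  = ∃′ (lookup π i) (permute φ)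

  module _ {Rel : Set} {π ρ : Transf n} (inv : Inverse π ρ) (𝔐 : Model 𝔾 n Rel) where

    private
      πρ : ∀ k → lookup π (lookup ρ k) ≡ k
      πρ = lookup-inverse {π = π} {ρ} (proj₁ inv)
      ρπ : ∀ k → lookup ρ (lookup π k) ≡ k
      ρπ = lookup-inverse {π = ρ} {π} (proj₂ inv)

    permute-sound    : ∀ (s t : Assignment 𝔐) → proj₁ t ≡ proj₁ s ⊙ π →
                       ∀ φ → Sat 𝔐 s (permute π φ) → Sat 𝔐 t φ
    permute-complete : ∀ (s t : Assignment 𝔐) → proj₁ t ≡ proj₁ s ⊙ π →
                       ∀ φ → Sat 𝔐 t φ → Sat 𝔐 s (permute π φ)
    permute-sound (s , _) t refl (rel R a) p = subst (interp 𝔐 R) (sym (⊙-assoc s π a)) p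
    permute-sound (s , _) t refl (i ≐ j) p = trans (lookup-⊙ s π i) (trans p (sym (lookup-⊙ s π j)))
    permute-sound s t eq (¬′ φ) ¬p q = ¬p (permute-complete s t eq φ q)
    permute-sound s t eq (φ ∧′ ψ) (p , q) = permute-sound s t eq φ p , permute-sound s t eq ψ q
    permute-sound s t eq (φ ∨′ ψ) (inj₁ p) = inj₁ (permute-sound s t eq φ p)
    permute-sound s t eq (φ ∨′ ψ) (inj₂ p) = inj₂ (permute-sound s t eq ψ p)
    permute-sound s t eq (φ ⇒′ ψ) f p = permute-sound s t eq ψ (f (permute-complete s t eq φ p))
    permute-sound (s , _) t refl (∃′ i φ) ((u , Vu) , u∼s , p) =
      (u ⊙ π , isUnit 𝔐 u Vu π) ,
      (λ k k≢i → trans (lookup-⊙ u π k)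
        (trans (u∼s _ (λ eq → k≢i (trans (sym (ρπ k)) (trans (cong (lookup ρ) eq) (ρπ i)))))
               (sym (lookup-⊙ s π k)))) ,
      permute-sound (u , Vu) _ refl φ p
    permute-complete (s , _) t refl (rel R a) p = subst (interp 𝔐 R) (⊙-assoc s π a) p
    permute-complete (s , _) t refl (i ≐ j) p = trans (sym (lookup-⊙ s π i)) (trans p (lookup-⊙ s π j))
    permute-complete s t eq (¬′ φ) ¬p q = ¬p (permute-sound s t eq φ q)
    permute-complete s t eq (φ ∧′ ψ) (p , q) = permute-complete s t eq φ p , permute-complete s t eq ψ q
    permute-complete s t eq (φ ∨′ ψ) (inj₁ p) = inj₁ (permute-complete s t eq φ p)
    permute-complete s t eq (φ ∨′ ψ) (inj₂ p) = inj₂ (permute-complete s t eq ψ p)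
    permute-complete s t eq (φ ⇒′ ψ) f p = permute-complete s t eq ψ (f (permute-sound s t eq φ p))
    permute-complete (s , _) t refl (∃′ i φ) ((u , Vu) , u∼t , p) =
      (u ⊙ ρ , isUnit 𝔐 u Vu ρ) ,
      (λ k k≢πi → trans (lookup-⊙ u ρ k)
        (trans (u∼t _ (λ eq → k≢πi (trans (sym (πρ k)) (cong (lookup π) eq))))
          (trans (lookup-⊙ s π _) (cong (lookup s) (πρ k))))) ,
      permute-complete _ (u , Vu)
        (sym (trans (⊙-assoc u ρ π) (trans (cong (u ⊙_) (proj₂ inv)) (⊙-allFin u)))) φ p

-- Substitutions that formulas can express.
module Substitutions (em : ExcludedMiddle (ℓsuc 0ℓ)) {C : Class} {n : ℕ} {Rel : Set} where
  open Classical em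
  open Transformations
  open import Data.Nat.Base using (ℕ)
  open import Data.Fin.Base using (Fin)
  open import Data.Vec.Base using (Vec; allFin)
  open Model

  module _ (𝔐 : Model C n Rel) where

    -- Satisfaction does not depend on the proof that the assignment lies in V.
    Sat-cong : ∀ {s t : Assignment 𝔐} φ → proj₁ s ≡ proj₁ t → Sat 𝔐 s φ → Sat 𝔐 t φ
    Sat-cong (rel R a) refl p         = p
    Sat-cong (i ≐ j)   refl p         = p
    Sat-cong (¬′ φ)    eq ¬p q        = ¬p (Sat-cong φ (sym eq) q)
    Sat-cong (φ ∧′ ψ)  eq (p , q)     = Sat-cong φ eq p , Sat-cong ψ eq q
    Sat-cong (φ ∨′ ψ)  eq (inj₁ p)    = inj₁ (Sat-cong φ eq p)
    Sat-cong (φ ∨′ ψ)  eq (inj₂ q)    = inj₂ (Sat-cong ψ eq q)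
    Sat-cong (φ ⇒′ ψ)  eq f p         = Sat-cong ψ eq (f (Sat-cong φ (sym eq) p))
    Sat-cong (∃′ i φ)  refl p         = p

  -- A transformation τ under which units are closed, and a map on formulas with the effect
  -- of τ: form φ holds at s iff φ holds at s ∘ τ.
  record Subst : Set₁ where
    field
      τ      : Transf n
      form   : Formula C n Rel → Formula C n Rel
      keep   : ∀ {M : Set} {V : Pred (Vec M n) 0ℓ} → IsUnit C V → ∀ {s} → V s → V (s ⊙ τ)
      sound  : ∀ (𝔐 : Model C n Rel) (s t : Assignment 𝔐) → proj₁ t ≡ proj₁ s ⊙ τ →
               ∀ φ → Sat 𝔐 s (form φ) → Sat 𝔐 t φ
      complete : ∀ (𝔐 : Model C n Rel) (s t : Assignment 𝔐) → proj₁ t ≡ proj₁ s ⊙ τ →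
               ∀ φ → Sat 𝔐 t φ → Sat 𝔐 s (form φ)

    shift : ∀ (𝔐 : Model C n Rel) → Assignment 𝔐 → Assignment 𝔐
    shift 𝔐 (s , Vs) = s ⊙ τ , keep (isUnit 𝔐) Vs

  open Subst

  idSubst : Subst
  idSubst = record
    { τ        = allFin n
    ; form     = id
    ; keep     = λ {_} {V} _ {s} Vs → subst V (sym (⊙-allFin s)) Vs
    ; sound    = λ 𝔐 s t eq φ → Sat-cong 𝔐 φ (sym (trans eq (⊙-allFin (proj₁ s))))
    ; complete = λ 𝔐 s t eq φ → Sat-cong 𝔐 φ (trans eq (⊙-allFin (proj₁ s)))
    }

  infixl 9 _∙_
  _∙_ : Subst → Subst → Subst
  w ∙ v = record
    { τ        = τ w ⊙ τ v
    ; form     = form w ∘ form v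
    ; keep     = λ {_} {V} unit {s} Vs → subst V (⊙-assoc s (τ w) (τ v)) (keep v unit (keep w unit Vs))
    ; sound    = λ 𝔐 s t eq φ p → sound v 𝔐 (shift w 𝔐 s) t
                   (trans eq (sym (⊙-assoc (proj₁ s) (τ w) (τ v)))) φ (sound w 𝔐 s (shift w 𝔐 s) refl _ p)
    ; complete = λ 𝔐 s t eq φ p → complete w 𝔐 s (shift w 𝔐 s) refl _
                   (complete v 𝔐 (shift w 𝔐 s) t (trans eq (sym (⊙-assoc (proj₁ s) (τ w) (τ v)))) φ p)
    }

  -- Substitution of xⱼ for xᵢ: the only point s′ ∼[ i ] s with s′ᵢ = s′ⱼ is s ∘ [ i ∣ j ].
  replace : ∀ i j → i ≢ j → Subst
  replace i j i≢j = record
    { τ        = [ i ∣ j ]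
    ; form     = λ φ → ∃′ i (i ≐ j ∧′ φ)
    ; keep     = λ unit → unit-[∣] C unit i j
    ; sound    = λ { 𝔐 s t eq φ (u , u∼s , uᵢ≡uⱼ , p) →
                     Sat-cong 𝔐 φ (trans (replaced {s = proj₁ s} i≢j u∼s uᵢ≡uⱼ) (sym eq)) p }
    ; complete = λ { 𝔐 (s , _) (_ , Vt) refl φ p → (s ⊙ [ i ∣ j ] , Vt) , [∣]-∼ s i j , [∣]-≡ s i≢j , p }
    }

  -- A substitution with an inverse.
  record Renaming : Set₁ where
    field
      there back : Subst
      back∘there : τ there ⊙ τ back ≡ allFin n
      there∘back : τ back ⊙ τ there ≡ allFin n

    there-back : ∀ {A : Set} (s : Vec A n) → s ⊙ τ there ⊙ τ back ≡ s
    there-back s = trans (⊙-assoc s (τ there) (τ back)) (trans (cong (s ⊙_) back∘there) (⊙-allFin s))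

    back-there : ∀ {A : Set} (s : Vec A n) → s ⊙ τ back ⊙ τ there ≡ s
    back-there s = trans (⊙-assoc s (τ back) (τ there)) (trans (cong (s ⊙_) there∘back) (⊙-allFin s))

  idRenaming : Renaming
  idRenaming = record
    { there = idSubst ; back = idSubst ; back∘there = ⊙-allFin _ ; there∘back = ⊙-allFin _ }

-- Steps from one point of a unit to another.
module Moves (em : ExcludedMiddle (ℓsuc 0ℓ)) where
  open Classical em
  open Transformations
  open Permutations
  open Substitutions em
  open Coding
  open import Data.Nat.Base using (ℕ)
  open import Data.Fin.Base using (Fin)
  open import Data.Fin.Properties using (_≟_)
  open import Data.Vec.Base using (Vec; lookup; allFin)
  open import Data.Vec.Properties using (lookup-allFin)
  open Subst
  open Renaming

  permutation : ∀ {n} {Rel : Set} {π ρ : Transf n} → Inverse π ρ → Subst {𝔾} {n} {Rel}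
  permutation {Rel = Rel} {π} {ρ} inv = record
    { τ        = π
    ; form     = permute π
    ; keep     = λ unit {s} Vs → unit s Vs π
    ; sound    = permute-sound {Rel = Rel} {π = π} {ρ} inv
    ; complete = permute-complete {Rel = Rel} {π = π} {ρ} inv
    }

  -- Renaming by π; by convention the identity when C is 𝔻 or π is not a permutation.
  renamingBy : ∀ C {n} {Rel : Set} → Transf n → Renaming {C} {n} {Rel}
  renamingBy 𝔻 π = idRenaming
  renamingBy 𝔾 π with em₀ {∃ (Inverse π)}
  ... | no _ = idRenaming
  ... | yes (ρ , πρ , ρπ) = record
    { there      = permutation {π = π} {ρ} (πρ , ρπ)
    ; back       = permutation {π = ρ} {π} (ρπ , πρ)
    ; back∘there = πρ
    ; there∘back = ρπ
    }

  renamingBy-τ : ∀ {C n} {Rel : Set} → C ≡ 𝔾 → ∀ {π ρ : Transf n} → Inverse π ρ →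
                 τ (there (renamingBy C {n} {Rel} π)) ≡ π
  renamingBy-τ refl {π} {ρ} inv with em₀ {∃ (Inverse π)}
  ... | no ¬inv = ⊥-elim (¬inv (ρ , inv))
  ... | yes _   = refl

  [i∣i]≡id : ∀ {n} (i : Fin n) → [ i ∣ i ] ≡ allFin n
  [i∣i]≡id i = vec-ext λ k → pointwise k (k ≟ i)
    where
    pointwise : ∀ k → Dec (k ≡ i) → lookup [ i ∣ i ] k ≡ lookup (allFin _) k
    pointwise k (yes refl) = trans (lookup-[∣]-≡ i i) (sym (lookup-allFin i))
    pointwise k (no k≢i)   = trans (lookup-[∣]-≢ i i k≢i) (sym (lookup-allFin k))

  ⊙[i∣i] : ∀ {A : Set} {n} (s : Vec A n) i → s ⊙ [ i ∣ i ] ≡ s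
  ⊙[i∣i] s i = trans (cong (s ⊙_) ([i∣i]≡id i)) (⊙-allFin s)

  -- Over 𝔾, all transformations are expressible.
  substitution : ∀ {n} {Rel : Set} (τ₀ : Transf n) → Σ[ w ∈ Subst {𝔾} {n} {Rel} ] τ w ≡ τ₀
  substitution = transf-induction _ (λ π ρ inv → permutation {π = π} {ρ} inv , refl) step
    where
    step : ∀ σ a b → Σ[ w ∈ Subst ] τ w ≡ σ → Σ[ w ∈ Subst ] τ w ≡ σ ⊙ [ a ∣ b ]
    step σ a b (w , eq) with a ≟ b
    ... | yes refl = w , trans eq (sym (⊙[i∣i] σ a))
    ... | no a≢b   = w ∙ replace a b a≢b , cong (_⊙ [ a ∣ b ]) eq

  -- The substitution that carries R(x₀,…,xₙ₋₁) to the atomic formula with arguments a.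
  argSubst : ∀ C {n} {Rel : Set} (a : Args C n) →
             Σ[ w ∈ Subst {C} {n} {Rel} ] (∀ {M : Set} (s : Vec M n) → select C a s ≡ s ⊙ τ w)
  argSubst 𝔻 _ = idSubst , λ s → sym (⊙-allFin s)
  argSubst 𝔾 a = let (w , eq) = substitution a in w , λ s → cong (s ⊙_) (sym eq)

  idArgs : ∀ C {n} → Args C n
  idArgs 𝔻 = _
  idArgs 𝔾 = allFin _

  select-idArgs : ∀ C {n} {M : Set} (s : Vec M n) → select C (idArgs C) s ≡ s
  select-idArgs 𝔻 s = refl
  select-idArgs 𝔾 s = ⊙-allFin s

  -- The steps along which types are connected: to a point that differs at xᵢ only and
  -- satisfies φ if any such point does, or to the point with permuted coordinates.
  data Move (C : Class) (n : ℕ) (Rel : Set) : Set where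
    witness : Fin n → Formula C n Rel → Move C n Rel
    rename  : Transf n → Move C n Rel

  Move-countable : ∀ {C n} {Rel : Set} → Countable Rel → Countable (Move C n Rel)
  Move-countable {C} {n} {Rel} c = ↣-countable f (λ {x} {y} → inj x y)
    (⊎-countable (×-countable Fin-countable (Formula-countable c)) (Vec-countable Fin-countable))
    where
    f : Move C n Rel → (Fin n × Formula C n Rel) ⊎ Transf n
    f (witness i φ) = inj₁ (i , φ)
    f (rename π)    = inj₂ π
    inj : ∀ x y → f x ≡ f y → x ≡ y
    inj (witness i φ) (witness j ψ) refl = refl
    inj (rename π)    (rename ρ)    refl = refl

-- Complete types and their derived types.
module Types (em : ExcludedMiddle (ℓsuc 0ℓ)) {C : Class} {n : ℕ} {Rel : Set}
             (T : Pred (Formula C n Rel) 0ℓ) where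
  open Classical em
  open Transformations
  open Substitutions em
  open Moves em
  open Coding
  open Guessing em using (Guess; Guess-Maybe; genericSequence)
  open import Data.Nat.Base as ℕ using (zero; suc; _≤_; _⊔_)
  import Data.Nat.Properties as ℕ
  open import Data.Fin.Base using (Fin)
  open import Data.List.Base using (List; []; _∷_; foldr)
  open import Data.List.Relation.Unary.All using (All; []; _∷_)
  open Subst
  open Renaming

  Form : Set
  Form = Formula C n Rel

  -- Satisfiable at some point of some model of T.
  Satisfiable : Form → Set₁
  Satisfiable φ = Σ[ 𝔐 ∈ Model C n Rel ] (IsModelOf T 𝔐 × Σ[ s ∈ Model.Assignment 𝔐 ] Sat 𝔐 s φ)

  -- Φ ⊢ χ: at every point of every model of T where all of Φ holds, χ holds.
  infix 3 _⊢_
  _⊢_ : List Form → Form → Set₁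
  Φ ⊢ χ = ∀ 𝔐 → IsModelOf T 𝔐 → ∀ s → All (Sat 𝔐 s) Φ → Sat 𝔐 s χ

  satisfiable⇒consistentWith : ∀ {φ} → Satisfiable φ → ConsistentWith T φ
  satisfiable⇒consistentWith (𝔐 , mod , s , p) valid = valid 𝔐 mod s p

  -- Complete types over T: ultrafilters in the Lindenbaum algebra of T.
  record IsType (p : Form → Set) : Set₁ where
    field
      ∧-closed : ∀ {φ ψ} → p φ → p ψ → p (φ ∧′ ψ)
      sat      : ∀ {φ} → p φ → Satisfiable φ
      max      : ∀ φ → p φ ⊎ p (¬′ φ)

    -- Complete types are closed under consequence.
    entail : ∀ {Φ χ} → All p Φ → Φ ⊢ χ → p χ
    entail {Φ} {χ} pΦ Φ⊢χ with max χ
    ... | inj₁ pχ  = pχ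
    ... | inj₂ p¬χ = let (𝔐 , mod , s , q) = sat (conj pΦ) ; (sΦ , ¬sχ) = unpack Φ q in
      ⊥-elim (¬sχ (Φ⊢χ 𝔐 mod s sΦ))
      where
      conj : ∀ {Ψ} → All p Ψ → p (foldr _∧′_ (¬′ χ) Ψ)
      conj []         = p¬χ
      conj (pψ ∷ pΨ) = ∧-closed pψ (conj pΨ)
      unpack : ∀ {𝔐 s} Ψ → Sat 𝔐 s (foldr _∧′_ (¬′ χ) Ψ) → All (Sat 𝔐 s) Ψ × ¬ Sat 𝔐 s χ
      unpack []      q       = [] , q
      unpack (ψ ∷ Ψ) (q , r) = let (qs , ¬χ) = unpack Ψ r in q ∷ qs , ¬χ

    consistent : ∀ {φ} → p φ → ¬ p (¬′ φ)
    consistent {φ} pφ p¬φ = let (_ , _ , _ , q , ¬q) = sat (∧-closed pφ p¬φ) in ¬q q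

    ¬-intro : ∀ {φ} → ¬ p φ → p (¬′ φ)
    ¬-intro {φ} ¬pφ with max φ
    ... | inj₁ pφ  = ⊥-elim (¬pφ pφ)
    ... | inj₂ p¬φ = p¬φ

  open IsType

  -- A set Con of conditions rich enough for a generic filter to be a complete type.
  record ConsistencyProperty (Con : Form → Set) : Set₁ where
    field
      mono  : ∀ {ψ φ} → Con ψ → (ψ ∷ []) ⊢ φ → Con φ
      split : ∀ {ψ} φ → Con ψ → Con (ψ ∧′ φ) ⊎ Con (ψ ∧′ ¬′ φ)
      sat   : ∀ {φ} → Con φ → Satisfiable φ

  module _ {Con : Form → Set} (isCon : ConsistencyProperty Con) (cForm : Countable Form)
           {J : Set} (G : Guess J) {W : Set} (cW : Countable W)
           (D : J → W → Form → Set)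
           (dense : ∀ j w {ψ} → Con ψ → ∃[ φ ] (D j w φ × Con (ψ ∧′ φ))) where
    open ConsistencyProperty isCon renaming (sat to Con-sat)

    private
      -- Besides the given tasks, each formula has to be decided.
      Task : Maybe J → ℕ.ℕ → Form → Set
      Task nothing  k φ = ∀ χ → code cForm χ ≡ k → φ ≡ χ ⊎ φ ≡ (¬′ χ)
      Task (just j) k φ = ∀ w → code cW w ≡ k → D j w φ

      duplicate : ∀ {ψ} → Con ψ → Con (ψ ∧′ ψ)
      duplicate con = mono con λ { _ _ _ (p ∷ []) → p , p }

      task-dense : ∀ j k {ψ} → Con ψ → ∃[ φ ] (Task j k φ × Con (ψ ∧′ φ))
      task-dense nothing k {ψ} con with em₀ {∃[ χ ] code cForm χ ≡ k}
      ... | no none = ψ , (λ χ eq → ⊥-elim (none (χ , eq))) , duplicate con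
      ... | yes (χ , eq) with split χ con
      ...   | inj₁ con′ = χ , (λ χ′ eq′ → inj₁ (code-injective cForm (trans eq (sym eq′)))) , con′
      ...   | inj₂ con′ = (¬′ χ) ,
        (λ χ′ eq′ → inj₂ (cong ¬′_ (code-injective cForm (trans eq (sym eq′))))) , con′
      task-dense (just j) k {ψ} con with em₀ {∃[ w ] code cW w ≡ k}
      ... | no none = ψ , (λ w eq → ⊥-elim (none (w , eq))) , duplicate con
      ... | yes (w , eq) = let (φ , d , con′) = dense j w con in
        φ , (λ w′ eq′ → subst (λ v → D j v φ) (code-injective cW (trans eq (sym eq′))) d) , con′

      -- Extension of conditions.
      _≽_ : Form → Form → Set₁
      ψ ≽ ψ′ = Con ψ → Con ψ′ × ((ψ′ ∷ []) ⊢ ψ)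

      ≽-refl : ∀ {ψ} → ψ ≽ ψ
      ≽-refl con = con , λ { _ _ _ (p ∷ []) → p }

      ≽-trans : ∀ {ψ χ φ} → ψ ≽ χ → χ ≽ φ → ψ ≽ φ
      ≽-trans f g con = let (con₁ , e₁) = f con ; (con₂ , e₂) = g con₁ in
        con₂ , λ 𝔐 mod s q → e₁ 𝔐 mod s (e₂ 𝔐 mod s q ∷ [])

      Meets : Maybe J → ℕ.ℕ → Form → Set₁
      Meets j k ψ = ∃[ φ ] (Task j k φ × ((ψ ∷ []) ⊢ φ))

      meet : ∀ j k ψ → Σ[ ψ′ ∈ Form ] (ψ ≽ ψ′ × (Con ψ → Meets j k ψ′))
      meet j k ψ with em₀ {Con ψ}
      ... | no ¬con = ψ , ≽-refl , ⊥-elim ∘ ¬con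
      ... | yes con = let (φ , task , con′) = task-dense j k con in
        (ψ ∧′ φ) , (λ _ → con′ , λ { _ _ _ ((p , _) ∷ []) → p }) ,
        (λ _ → φ , task , λ { _ _ _ ((_ , q) ∷ []) → q })

      abstract
        meetAll : ∀ j n ψ → Σ[ ψ′ ∈ Form ] (ψ ≽ ψ′ × (Con ψ → ∀ k → k ≤ n → Meets j k ψ′))
        meetAll j zero    ψ = let (ψ′ , ext , m) = meet j 0 ψ in ψ′ , ext , λ { con zero _ → m con }
        meetAll j (suc n) ψ =
          let (ψ₁ , ext₁ , m₁) = meetAll j n ψ
              (ψ₂ , ext₂ , m₂) = meet j (suc n) ψ₁
              con₁ = λ con → proj₁ (ext₁ con)
              all : Con ψ → ∀ k → k ≤ suc n → Meets j k ψ₂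
              all = λ con k k≤sn → case ℕ.m≤n⇒m<n∨m≡n k≤sn of λ
                { (inj₁ k<sn) → let (φ , task , e) = m₁ con k (ℕ.s≤s⁻¹ k<sn) in
                    φ , task , λ 𝔐 mod s q → e 𝔐 mod s (proj₂ (ext₂ (con₁ con)) 𝔐 mod s q ∷ [])
                ; (inj₂ refl) → m₂ (con₁ con) }
          in ψ₂ , ≽-trans ext₁ ext₂ , all

      abstract
        chain : ∀ ψ₀ → Σ[ s ∈ (ℕ.ℕ → Form) ] (s 0 ≡ ψ₀ × (∀ n → s n ≽ s (suc n)) ×
                (∀ j k → ∃[ n ] (Con (s n) → Meets j k (s (suc n)))))
        chain ψ₀ =
          let (s , s0 , s-≽ , hits) = genericSequence (Guess-Maybe G) cForm ψ₀ _≽_ (λ {ψ} → ≽-refl {ψ})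
                (λ j n ψ → proj₁ (meetAll j n ψ)) (λ j n ψ → proj₁ (proj₂ (meetAll j n ψ)))
          in s , s0 , s-≽ , λ j k → let (n , k≤n , eq) = hits j k in
             n , λ con → subst (Meets j k) (sym eq) (proj₂ (proj₂ (meetAll j n (s n))) con k k≤n)

    -- A complete type inside Con that contains ψ₀ and meets every D j w.
    completeType : ∀ {ψ₀} → Con ψ₀ → Σ[ p ∈ (Form → Set) ]
      (IsType p × p ψ₀ × (∀ {φ} → p φ → Con φ) × (∀ j w → ∃[ φ ] (D j w φ × p φ)))
    completeType {ψ₀} con₀ = p , isType , p₀ , (λ {φ} → p⇒Con {φ}) , meets
      where
      s : ℕ.ℕ → Form
      s = proj₁ (chain ψ₀)
      s0≡ψ₀ : s 0 ≡ ψ₀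
      s0≡ψ₀ = proj₁ (proj₂ (chain ψ₀))
      s-≽ : ∀ n → s n ≽ s (suc n)
      s-≽ = proj₁ (proj₂ (proj₂ (chain ψ₀)))
      con : ∀ n → Con (s n)
      con zero    = subst Con (sym s0≡ψ₀) con₀
      con (suc n) = proj₁ (s-≽ n (con n))
      later : ∀ {m n φ} → m ≤ n → (s m ∷ []) ⊢ φ → (s n ∷ []) ⊢ φ
      later {n = zero}  ℕ.z≤n e = e
      later {n = suc n} {φ} m≤sn e with ℕ.m≤n⇒m<n∨m≡n m≤sn
      ... | inj₂ refl = e
      ... | inj₁ m<sn = λ 𝔐 mod t q →
        later {φ = φ} (ℕ.s≤s⁻¹ m<sn) e 𝔐 mod t (proj₂ (s-≽ n (con n)) 𝔐 mod t q ∷ [])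
      p : Form → Set
      p φ = ∃[ n ] ⌊ ((s n ∷ []) ⊢ φ) ⌋
      p⇒Con : ∀ {φ} → p φ → Con φ
      p⇒Con (n , e) = mono (con n) (⌊⌋-elim e)
      meetsTask : ∀ j k → ∃[ φ ] (Task j k φ × p φ)
      meetsTask j k =
        let (n , meet)     = proj₂ (proj₂ (proj₂ (chain ψ₀))) j k
            (φ , task , e) = meet (con n)
        in φ , task , suc n , ⌊⌋-intro e
      meets : ∀ j w → ∃[ φ ] (D j w φ × p φ)
      meets j w = let (φ , task , pφ) = meetsTask (just j) (code cW w) in φ , task w refl , pφ
      p₀ : p ψ₀
      p₀ = 0 , ⌊⌋-intro λ { _ _ _ (q ∷ []) → subst (Sat _ _) s0≡ψ₀ q }
      isType : IsType p
      isType = record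
        { ∧-closed = λ { {φ} {ψ} (m , e) (n , f) → m ⊔ n , ⌊⌋-intro λ 𝔐 mod t q →
            later {φ = φ} (ℕ.m≤m⊔n m n) (⌊⌋-elim e) 𝔐 mod t q ,
            later {φ = ψ} (ℕ.m≤n⊔m m n) (⌊⌋-elim f) 𝔐 mod t q }
        ; sat = λ {φ} pφ → Con-sat (p⇒Con {φ} pφ)
        ; max = decides
        }
        where
        decides : ∀ φ → p φ ⊎ p (¬′ φ)
        decides φ with meetsTask nothing (code cForm φ)
        ... | ψ , task , pψ with task φ refl
        ...   | inj₁ refl = inj₁ pψ
        ...   | inj₂ refl = inj₂ pψ

  -- The sets of formulas that a type has to omit so that the types reachable from it by
  -- the moves w can omit Γ.  A type p containing ∃xᵢψ contains the negation of the
  -- formula derived from γ iff ψ ∧ ¬γ is a condition for the xᵢ-neighbours of p.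
  Derived : Pred Form 0ℓ → List (Move C n Rel) → Pred Form 0ℓ
  Derived Γ []                χ = Γ χ
  Derived Γ (witness i ψ ∷ w) χ = ∃[ γ ] (Derived Γ w γ × χ ≡ (∃′ i ψ ∧′ ¬′ ∃′ i (ψ ∧′ ¬′ γ)))
  Derived Γ (rename π ∷ w)    χ = ∃[ γ ] (Derived Γ w γ × χ ≡ form (there (renamingBy C π)) γ)

  -- Every satisfiable formula is satisfiable at a point that does not realize Δ, and this is
  -- witnessed by one γ ∈ Δ.  A reformulation of non-principality.
  Avoidable : Pred Form 0ℓ → Set₁
  Avoidable Δ = ∀ χ → Satisfiable χ → ∃[ γ ] (Δ γ × Satisfiable (χ ∧′ ¬′ γ))

  nonPrincipal⇒avoidable : ∀ {Γ} → NonPrincipal T Γ → Avoidable Γ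
  nonPrincipal⇒avoidable nonPr χ satχ = byContradiction₁ λ none →
    nonPr (χ , satisfiable⇒consistentWith {χ} satχ , λ γ Γγ 𝔐 mod s p →
      byContradiction λ ¬q → none (γ , Γγ , 𝔐 , mod , s , p , ¬q))

  avoidable-derived : ∀ {Γ} → Avoidable Γ → ∀ w → Avoidable (Derived Γ w)
  avoidable-derived av [] = av
  avoidable-derived {Γ} av (witness i ψ ∷ w) χ (𝔐 , mod , s , p) with em₀ {Sat 𝔐 s (∃′ i ψ)}
  ... | no ¬∃ = let (γ , Δγ , _) = avoidable-derived {Γ} av w χ (𝔐 , mod , s , p) in
    _ , (γ , Δγ , refl) , 𝔐 , mod , s , p , ¬∃ ∘ proj₁
  ... | yes (t , t∼s , q) =
    let (γ , Δγ , 𝔑 , mod′ , u , (q′ , v , v∼u , p′) , ¬γ) =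
          avoidable-derived {Γ} av w (ψ ∧′ ∃′ i χ) (𝔐 , mod , t , q , s , (λ k k≢i → sym (t∼s k k≢i)) , p)
    in _ , (γ , Δγ , refl) , 𝔑 , mod′ , v , p′ ,
       λ (_ , ¬∃) → ¬∃ (u , (λ k k≢i → sym (v∼u k k≢i)) , q′ , ¬γ)
  avoidable-derived {Γ} av (rename π ∷ w) χ (𝔐 , mod , s , p) =
    let r = renamingBy C π
        (γ , Δγ , 𝔑 , mod′ , u , p′ , ¬γ) = avoidable-derived {Γ} av w (form (back r) χ)
          (𝔐 , mod , shift (there r) 𝔐 s ,
           complete (back r) 𝔐 (shift (there r) 𝔐 s) s (sym (there-back r (proj₁ s))) χ p)
        v = shift (back r) 𝔑 u
    in _ , (γ , Δγ , refl) , 𝔑 , mod′ , v , sound (back r) 𝔑 u v refl χ p′ ,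
       λ q → ¬γ (sound (there r) 𝔑 v u (sym (back-there r (proj₁ u))) γ q)

-- The tree of good types and the model built from it.
module Construction (em : ExcludedMiddle (ℓsuc 0ℓ)) {C : Class} {n : ℕ} {Rel : Set}
             (T : Pred (Formula C n Rel) 0ℓ) where
  open Classical em
  open Transformations
  open Substitutions em
  open Moves em
  open Coding
  open Guessing em using (Guess)
  open Types em T
  open import Data.Nat.Base as ℕ using (ℕ; zero; suc)
  import Data.Nat.Properties as ℕ
  open import Data.Fin.Base using (Fin; zero; suc; toℕ; fromℕ<)
  open import Data.Fin.Properties using (_≟_)
  open import Data.Vec.Base using (Vec; lookup; allFin; tabulate; _[_]≔_)
  open import Data.Vec.Properties using (lookup∘tabulate; lookup∘update; lookup∘update′)
  open import Data.List.Base as List using (List; []; _∷_; length)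
  open import Data.List.Relation.Unary.All using (All; []; _∷_)
  open import Data.List.Relation.Unary.All.Properties using (tabulate⁺; tabulate⁻)
  open import Data.Bool.Properties using (T-irrelevant)
  open Subst
  open Renaming
  open IsType

  Iff : Set → Set → Set
  Iff A B = (A → B) × (B → A)

  -- If p is the type of s, then p ∘ form w is the type of s ∘ τ.
  IsType-subst : ∀ {p} (w : Subst) → IsType p → IsType (p ∘ form w)
  IsType-subst {p} w ty = record
    { ∧-closed = λ {φ} {ψ} pφ pψ → entail ty {χ = form w (φ ∧′ ψ)} (pφ ∷ pψ ∷ [])
        λ { 𝔐 _ s (qφ ∷ qψ ∷ []) → complete w 𝔐 s (shift w 𝔐 s) refl (φ ∧′ ψ)
              (sound w 𝔐 s (shift w 𝔐 s) refl φ qφ , sound w 𝔐 s (shift w 𝔐 s) refl ψ qψ) }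
    ; sat      = λ {φ} pφ → let (𝔐 , mod , s , q) = sat ty pφ in
        𝔐 , mod , shift w 𝔐 s , sound w 𝔐 s (shift w 𝔐 s) refl φ q
    ; max      = λ φ → max-subst φ (max ty (form w φ))
    }
    where
    max-subst : ∀ φ → p (form w φ) ⊎ p (¬′ form w φ) → p (form w φ) ⊎ p (form w (¬′ φ))
    max-subst φ (inj₁ q) = inj₁ q
    max-subst φ (inj₂ q) = inj₂ (entail ty {χ = form w (¬′ φ)} (q ∷ [])
      λ { 𝔐 _ s (¬r ∷ []) → complete w 𝔐 s (shift w 𝔐 s) refl (¬′ φ)
            (λ r → ¬r (complete w 𝔐 s (shift w 𝔐 s) refl φ r)) })

  -- Types p and q that can be those of points s and t with s ∼[ i ] t.
  Neighbour : Fin n → (Form → Set) → (Form → Set) → Set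
  Neighbour i p q = ∀ {φ} → q φ → p (∃′ i φ)

  -- The conditions for a neighbour of p.
  neighbour-property : ∀ {p} → IsType p → ∀ i → ConsistencyProperty (λ ψ → p (∃′ i ψ))
  neighbour-property {p} ty i = record
    { mono  = λ {ψ} {φ} con e → entail ty {χ = ∃′ i φ} (con ∷ [])
                λ { 𝔐 mod s ((t , t∼s , q) ∷ []) → t , t∼s , e 𝔐 mod t (q ∷ []) }
    ; split = λ {ψ} φ con → splits ψ φ con (max ty (∃′ i (ψ ∧′ φ)))
    ; sat   = λ con → let (𝔐 , mod , _ , t , _ , q) = sat ty con in 𝔐 , mod , t , q
    }
    where
    splits : ∀ ψ φ → p (∃′ i ψ) → p (∃′ i (ψ ∧′ φ)) ⊎ p (¬′ ∃′ i (ψ ∧′ φ)) →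
             p (∃′ i (ψ ∧′ φ)) ⊎ p (∃′ i (ψ ∧′ ¬′ φ))
    splits ψ φ con (inj₁ q) = inj₁ q
    splits ψ φ con (inj₂ q) = inj₂ (entail ty {χ = ∃′ i (ψ ∧′ ¬′ φ)} (con ∷ q ∷ [])
      λ { 𝔐 mod s ((t , t∼s , r) ∷ ¬r ∷ []) → t , t∼s , r , λ r′ → ¬r (t , t∼s , r , r′) })

  -- The truth value of φ does not depend on the i-th coordinate.
  Invariant : Fin n → Form → Set₁
  Invariant i φ = ∀ 𝔐 (s t : Model.Assignment 𝔐) → proj₁ s ∼[ i ] proj₁ t → Sat 𝔐 s φ → Sat 𝔐 t φ

  neighbour-invariant : ∀ {p q i φ} → IsType p → IsType q → Neighbour i p q → Invariant i φ →
                        Iff (q φ) (p φ)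
  neighbour-invariant {p} {q} {i} {φ} typ tyq nb inv =
    (λ qφ → entail typ {χ = φ} (nb qφ ∷ []) λ { 𝔐 _ s ((t , t∼s , r) ∷ []) → inv 𝔐 t s t∼s r }) ,
    (λ pφ → byContradiction λ ¬qφ → consistent typ pφ
      (entail typ {χ = ¬′ φ} (nb (¬-intro tyq ¬qφ) ∷ [])
        λ { 𝔐 _ s ((t , t∼s , ¬r) ∷ []) r → ¬r (inv 𝔐 s t (λ k k≢i → sym (t∼s k k≢i)) r) }))

  subst-≐ : ∀ {p} → IsType p → ∀ w k l → Iff (p (form w (k ≐ l))) (p (lookup (τ w) k ≐ lookup (τ w) l))
  subst-≐ ty w k l =
    (λ q → entail ty {χ = lookup (τ w) k ≐ lookup (τ w) l} (q ∷ []) λ { 𝔐 _ s (r ∷ []) →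
      trans (sym (lookup-⊙ (proj₁ s) (τ w) k))
        (trans (sound w 𝔐 s (shift w 𝔐 s) refl (k ≐ l) r) (lookup-⊙ (proj₁ s) (τ w) l)) }) ,
    (λ q → entail ty {χ = form w (k ≐ l)} (q ∷ []) λ { 𝔐 _ s (r ∷ []) →
      complete w 𝔐 s (shift w 𝔐 s) refl (k ≐ l)
        (trans (lookup-⊙ (proj₁ s) (τ w) k) (trans r (sym (lookup-⊙ (proj₁ s) (τ w) l)))) })

  module _ (1<n : 1 ℕ.< n) (cRel : Countable Rel)
           {I : Set} (G : Guess I) (Γ : I → Pred Form 0ℓ) (avoidable : ∀ i → Avoidable (Γ i)) where

    Node : Set
    Node = List (Move C n Rel)

    Node-countable : Countable Node
    Node-countable = List-countable (Move-countable cRel)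

    -- A complete type that omits all derived types of all Γ i.
    record Good (p : Form → Set) : Set₁ where
      field
        isType : IsType p
        omits  : ∀ i w → ∃[ γ ] (Derived (Γ i) w γ × p (¬′ γ))

    open Good

    private
      -- φ is the negation of an element of the type derived from Γ i along w.
      Refutes : I → Node → Form → Set
      Refutes i w φ = ∃[ γ ] (Derived (Γ i) w γ × φ ≡ (¬′ γ))

      good : ∀ {p} → IsType p → (∀ i w → ∃[ φ ] (Refutes i w φ × p φ)) → Good p
      good {p} ty r = record { isType = ty ; omits = λ i w →
        let (_ , (γ , Δγ , eq) , pφ) = r i w in γ , Δγ , subst p eq pφ }

    abstract
      root : ∀ {φ} → Satisfiable φ → Σ[ p ∈ (Form → Set) ] Good p
      root {φ} satφ =
        let (p , ty , _ , _ , r) = completeType property (Formula-countable cRel) G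
                                      Node-countable Refutes dense {φ} (⌊⌋-intro satφ)
        in p , good ty r
        where
        property : ConsistencyProperty (λ ψ → ⌊ Satisfiable ψ ⌋)
        property = record
          { mono  = λ con e → let (𝔐 , mod , s , q) = ⌊⌋-elim con in ⌊⌋-intro (𝔐 , mod , s , e 𝔐 mod s (q ∷ []))
          ; split = λ {ψ} φ con → splits ψ φ (⌊⌋-elim con)
          ; sat   = ⌊⌋-elim
          }
          where
          splits : ∀ ψ φ → Satisfiable ψ → ⌊ Satisfiable (ψ ∧′ φ) ⌋ ⊎ ⌊ Satisfiable (ψ ∧′ ¬′ φ) ⌋
          splits ψ φ (𝔐 , mod , s , q) with em₀ {Sat 𝔐 s φ}
          ... | yes r = inj₁ (⌊⌋-intro (𝔐 , mod , s , q , r))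
          ... | no ¬r = inj₂ (⌊⌋-intro (𝔐 , mod , s , q , ¬r))
        dense : ∀ i w {ψ} → ⌊ Satisfiable ψ ⌋ → ∃[ φ ] (Refutes i w φ × ⌊ Satisfiable (ψ ∧′ φ) ⌋)
        dense i w {ψ} con = let (γ , Δγ , s) = avoidable-derived {Γ i} (avoidable i) w ψ (⌊⌋-elim con) in
          (¬′ γ) , (γ , Δγ , refl) , ⌊⌋-intro s

      -- A good type has good neighbours witnessing its existential formulas.  The formula
      -- ∃xᵢφ ⇒ φ can be required outright, since ∃xᵢ(∃xᵢφ ⇒ φ) is valid.
      neighbour : ∀ {p} → Good p → ∀ i φ →
                  Σ[ q ∈ (Form → Set) ] (Good q × q (∃′ i φ ⇒′ φ) × Neighbour i p q)
      neighbour {p} g i φ =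
        let (q , ty , q₀ , nb , r) = completeType (neighbour-property (isType g) i) (Formula-countable cRel) G
                                       Node-countable Refutes dense {∃′ i φ ⇒′ φ} start
        in q , good ty r , q₀ , (λ {ψ} → nb {ψ})
        where
        start : p (∃′ i (∃′ i φ ⇒′ φ))
        start = entail (isType g) {χ = ∃′ i (∃′ i φ ⇒′ φ)} [] λ 𝔐 _ s _ → valid 𝔐 s em₀
          where
          valid : ∀ 𝔐 s → Dec (Sat 𝔐 s (∃′ i φ)) → Sat 𝔐 s (∃′ i (∃′ i φ ⇒′ φ))
          valid 𝔐 s (yes (t , t∼s , q)) = t , t∼s , λ _ → q
          valid 𝔐 s (no ¬∃)             = s , (λ _ _ → refl) , λ e → ⊥-elim (¬∃ e)
        dense : ∀ j w {ψ} → p (∃′ i ψ) → ∃[ χ ] (Refutes j w χ × p (∃′ i (ψ ∧′ χ)))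
        dense j w {ψ} con with omits g j (witness i ψ ∷ w)
        ... | _ , (γ , Δγ , refl) , p¬ = (¬′ γ) , (γ , Δγ , refl) ,
          entail (isType g) {χ = ∃′ i (ψ ∧′ ¬′ γ)} (con ∷ p¬ ∷ [])
            λ { 𝔐 _ s (e ∷ ¬e ∷ []) → byContradiction λ ¬r → ¬e (e , ¬r) }

    renamed : ∀ {p} → Good p → ∀ π → Good (p ∘ form (there (renamingBy C π)))
    renamed {p} g π = record
      { isType = IsType-subst w (isType g)
      ; omits  = λ i v → refute i v (omits g i (rename π ∷ v))
      }
      where
      w : Subst
      w = there (renamingBy C π)
      refute : ∀ i v → ∃[ χ ] (Derived (Γ i) (rename π ∷ v) χ × p (¬′ χ)) →
               ∃[ γ ] (Derived (Γ i) v γ × p (form w (¬′ γ)))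
      refute i v (_ , (γ , Δγ , refl) , p¬) = γ , Δγ , entail (isType g) {χ = form w (¬′ γ)} (p¬ ∷ [])
        λ { 𝔐 _ s (¬r ∷ []) → complete w 𝔐 s (shift w 𝔐 s) refl (¬′ γ)
              (λ r → ¬r (complete w 𝔐 s (shift w 𝔐 s) refl γ r)) }

    module TypeTree {φ₀ : Form} (sat₀ : Satisfiable φ₀) where

      -- The type at a node.  The most recent move is at the head of the list.
      types : Node → Σ[ p ∈ (Form → Set) ] Good p
      types []                = root {φ₀} sat₀
      types (witness i φ ∷ σ) = let (q , g , _) = neighbour (proj₂ (types σ)) i φ in q , g
      types (rename π ∷ σ)    = _ , renamed (proj₂ (types σ)) π

      P : Node → Form → Set
      P σ = proj₁ (types σ)

      ty : ∀ σ → IsType (P σ)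
      ty σ = isType (proj₂ (types σ))

      P-witness : ∀ i φ σ → P (witness i φ ∷ σ) (∃′ i φ ⇒′ φ)
      P-witness i φ σ = proj₁ (proj₂ (proj₂ (neighbour (proj₂ (types σ)) i φ)))

      P-neighbour : ∀ i φ σ → Neighbour i (P σ) (P (witness i φ ∷ σ))
      P-neighbour i φ σ {ψ} = proj₂ (proj₂ (proj₂ (neighbour (proj₂ (types σ)) i φ))) {ψ}

      P-invariant : ∀ i φ σ {ψ} → Invariant i ψ → Iff (P (witness i φ ∷ σ) ψ) (P σ ψ)
      P-invariant i φ σ {ψ} = neighbour-invariant {φ = ψ} (ty σ) (ty (witness i φ ∷ σ))
        (λ {χ} → P-neighbour i φ σ {χ})

      -- Elements of the model are named by the node at which they appear, with a number that
      -- is needed only at the root.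
      Point : Set
      Point = Node × ℕ

      -- At the root, the k-th entry is named by the least m for which the type says xₖ = xₘ.
      LeastEqual : Fin n → ℕ → Set
      LeastEqual k m = (∃[ l ] (toℕ l ≡ m × P [] (k ≐ l))) × (∀ l → P [] (k ≐ l) → m ℕ.≤ toℕ l)

      -- The type at σ says that the i-th entry equals another one.
      Old : Fin n → Node → Set
      Old i σ = ∃[ k ] (i ≢ k × P σ (i ≐ k))

      -- The tuple after a step along xᵢ to the node σ, where s is the tuple before the step.
      place : ∀ i σ → Dec (Old i σ) → Vec Point n → Vec Point n
      place i σ (yes (k , _)) s = s ⊙ [ i ∣ k ]
      place i σ (no _)        s = s [ i ]≔ (σ , 0)

      ≐-refl : ∀ σ k → P σ (k ≐ k)
      ≐-refl σ k = entail (ty σ) {χ = k ≐ k} [] λ _ _ _ _ → refl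

      ≐-sym : ∀ σ {k l} → P σ (k ≐ l) → P σ (l ≐ k)
      ≐-sym σ {k} {l} p = entail (ty σ) {χ = l ≐ k} (p ∷ []) λ { _ _ _ (e ∷ []) → sym e }

      ≐-trans : ∀ σ {k l m} → P σ (k ≐ l) → P σ (l ≐ m) → P σ (k ≐ m)
      ≐-trans σ {k} {l} {m} p q = entail (ty σ) {χ = k ≐ m} (p ∷ q ∷ []) λ { _ _ _ (e ∷ f ∷ []) → trans e f }

      least : ∀ k → ∃ (LeastEqual k)
      least k = search (toℕ k) k (≐-refl [] k) ℕ.≤-refl
        where
        search : ∀ b l → P [] (k ≐ l) → toℕ l ℕ.≤ b → ∃ (LeastEqual k)
        search b l p l≤b with em₀ {∃[ m ] (P [] (k ≐ m) × toℕ m ℕ.< toℕ l)}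
        ... | no none = toℕ l , (l , refl , p) , λ m q → ℕ.≮⇒≥ λ m<l → none (m , q , m<l)
        search zero    l p l≤b | yes (m , q , m<l) = ⊥-elim (ℕ.n≮0 (ℕ.<-≤-trans m<l l≤b))
        search (suc b) l p l≤b | yes (m , q , m<l) = search b m q (ℕ.s≤s⁻¹ (ℕ.<-≤-trans m<l l≤b))

      -- The tuple at a node.
      tuple : Node → Vec Point n
      tuple []                = tabulate (λ k → [] , proj₁ (least k))
      tuple (witness i φ ∷ σ) = place i (witness i φ ∷ σ) em₀ (tuple σ)
      tuple (rename π ∷ σ)    = tuple σ ⊙ τ (there (renamingBy C {Rel = Rel} π))

      -- The entries of tuple σ are born at σ or at shorter nodes.
      birth : ∀ σ k → proj₁ (lookup (tuple σ) k) ≡ σ ⊎ length (proj₁ (lookup (tuple σ) k)) ℕ.< length σ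
      birth [] k = inj₁ (cong proj₁ (lookup∘tabulate (λ k → [] , proj₁ (least k)) k))
      birth (m ∷ σ) k = step m
        where
        older : ∀ {τ₀ : Transf n} {s} → s ≡ tuple σ ⊙ τ₀ →
                length (proj₁ (lookup s k)) ℕ.< suc (length σ)
        older {τ₀} refl = subst (λ e → length (proj₁ e) ℕ.< suc (length σ)) (sym (lookup-⊙ (tuple σ) τ₀ k))
          (young (birth σ (lookup τ₀ k)))
          where
          young : ∀ {β} → β ≡ σ ⊎ length β ℕ.< length σ → length β ℕ.< suc (length σ)
          young (inj₁ refl) = ℕ.n<1+n _
          young (inj₂ β<σ)  = ℕ.<-trans β<σ (ℕ.n<1+n _)
        placed : ∀ i σ′ d → proj₁ (lookup (place i σ′ d (tuple σ)) k) ≡ σ′ ⊎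
                 length (proj₁ (lookup (place i σ′ d (tuple σ)) k)) ℕ.< suc (length σ)
        placed i σ′ (yes (l , _)) = inj₂ (older {[ i ∣ l ]} refl)
        placed i σ′ (no _) with k ≟ i
        ... | yes refl = inj₁ (cong proj₁ (lookup∘update i (tuple σ) (σ′ , 0)))
        ... | no k≢i   = inj₂ (subst (λ e → length (proj₁ e) ℕ.< suc (length σ))
          (trans (cong (λ v → lookup v k) (⊙-allFin (tuple σ))) (sym (lookup∘update′ k≢i (tuple σ) (σ′ , 0))))
          (older {allFin n} refl))
        step : ∀ m → proj₁ (lookup (tuple (m ∷ σ)) k) ≡ (m ∷ σ) ⊎
               length (proj₁ (lookup (tuple (m ∷ σ)) k)) ℕ.< suc (length σ)
        step (witness i φ) = placed i (witness i φ ∷ σ) em₀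
        step (rename π)    = inj₂ (older {τ (there (renamingBy C {Rel = Rel} π))} refl)

      tuple-∼ : ∀ i φ σ → tuple (witness i φ ∷ σ) ∼[ i ] tuple σ
      tuple-∼ i φ σ = placed em₀
        where
        placed : ∀ d → place i (witness i φ ∷ σ) d (tuple σ) ∼[ i ] tuple σ
        placed (yes (l , _)) = [∣]-∼ (tuple σ) i l
        placed (no _) k k≢i  = lookup∘update′ k≢i (tuple σ) _

      ≐-invariant : ∀ {i k l} → k ≢ i → l ≢ i → Invariant i (k ≐ l)
      ≐-invariant k≢i l≢i 𝔐 s t s∼t e = trans (sym (s∼t _ k≢i)) (trans e (s∼t _ l≢i))

      -- If the new i-th entry is an old one, then the new point is s ∘ [ i ∣ k ].
      P-old : ∀ i φ σ {k} (i≢k : i ≢ k) → P (witness i φ ∷ σ) (i ≐ k) → ∀ ψ →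
              Iff (P (witness i φ ∷ σ) ψ) (P σ (form (replace i k i≢k) ψ))
      P-old i φ σ {k} i≢k i≐k ψ =
        (λ pψ → P-neighbour i φ σ {i ≐ k ∧′ ψ} (∧-closed (ty (witness i φ ∷ σ)) i≐k pψ)) ,
        (λ p → byContradiction λ ¬pψ → consistent (ty σ) p
          (entail (ty σ) {χ = ¬′ ∃′ i (i ≐ k ∧′ ψ)}
            (P-neighbour i φ σ {i ≐ k ∧′ ¬′ ψ}
              (∧-closed (ty (witness i φ ∷ σ)) i≐k (¬-intro (ty (witness i φ ∷ σ)) ¬pψ)) ∷ [])
            λ { 𝔐 _ s ((t , t∼s , tᵢ≡tₖ , ¬q) ∷ []) (u , u∼s , uᵢ≡uₖ , q) →
              ¬q (Sat-cong 𝔐 ψ (trans (replaced {s = proj₁ s} i≢k u∼s uᵢ≡uₖ)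
                                      (sym (replaced {s = proj₁ s} i≢k t∼s tᵢ≡tₖ))) q) }))

      -- Two entries of the tuple coincide iff the type says so.
      tuple-≡ : ∀ σ k l → Iff (lookup (tuple σ) k ≡ lookup (tuple σ) l) (P σ (k ≐ l))
      tuple-≡ [] k l = to , from
        where
        val : ∀ k → lookup (tuple []) k ≡ ([] , proj₁ (least k))
        val = lookup∘tabulate (λ k → [] , proj₁ (least k))
        to : lookup (tuple []) k ≡ lookup (tuple []) l → P [] (k ≐ l)
        to eq with least k | least l | trans (sym (val k)) (trans eq (val l))
        ... | _ , (a , refl , p) , _ | _ , (b , b≡a , q) , _ | eq′
          = ≐-trans [] p (≐-sym [] (subst (λ c → P [] (l ≐ c))
              (toℕ-injective (trans b≡a (sym (cong proj₂ eq′)))) q))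
          where open import Data.Fin.Properties using (toℕ-injective)
        ≤-least : ∀ {k l} → P [] (k ≐ l) → proj₁ (least k) ℕ.≤ proj₁ (least l)
        ≤-least {k} {l} p = let ((b , b≡ , q) , _) = proj₂ (least l) in
          subst (proj₁ (least k) ℕ.≤_) b≡ (proj₂ (proj₂ (least k)) b (≐-trans [] p q))
        from : P [] (k ≐ l) → lookup (tuple []) k ≡ lookup (tuple []) l
        from p = trans (val k)
          (trans (cong ([] ,_) (ℕ.≤-antisym (≤-least p) (≤-least (≐-sym [] p)))) (sym (val l)))
      tuple-≡ (rename π ∷ σ) k l =
        (λ eq → proj₂ at (proj₁ below (trans (sym (lookup-⊙ (tuple σ) (τ w) k))
          (trans eq (lookup-⊙ (tuple σ) (τ w) l))))) ,
        (λ p → trans (lookup-⊙ (tuple σ) (τ w) k)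
          (trans (proj₂ below (proj₁ at p)) (sym (lookup-⊙ (tuple σ) (τ w) l))))
        where
        w : Subst
        w     = there (renamingBy C π)
        at    = subst-≐ (ty σ) w k l
        below = tuple-≡ σ (lookup (τ w) k) (lookup (τ w) l)
      tuple-≡ (witness i φ ∷ σ) k l = placed em₀
        where
        σ′ = witness i φ ∷ σ
        placed : ∀ d →
          Iff (lookup (place i σ′ d (tuple σ)) k ≡ lookup (place i σ′ d (tuple σ)) l) (P σ′ (k ≐ l))
        placed (yes (m , i≢m , i≐m)) =
          (λ eq → proj₂ old (proj₂ at (proj₁ below
            (trans (sym (lookup-⊙ (tuple σ) [ i ∣ m ] k)) (trans eq (lookup-⊙ (tuple σ) [ i ∣ m ] l)))))) ,
          (λ p → trans (lookup-⊙ (tuple σ) [ i ∣ m ] k)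
            (trans (proj₂ below (proj₁ at (proj₁ old p))) (sym (lookup-⊙ (tuple σ) [ i ∣ m ] l))))
          where
          old   = P-old i φ σ i≢m i≐m (k ≐ l)
          at    = subst-≐ (ty σ) (replace i m i≢m) k l
          below = tuple-≡ σ (lookup [ i ∣ m ] k) (lookup [ i ∣ m ] l)
        placed (no new) = fresh (k ≟ i) (l ≟ i)
          where
          s′ = tuple σ [ i ]≔ (σ′ , 0)
          at-i : lookup s′ i ≡ (σ′ , 0)
          at-i = lookup∘update i (tuple σ) (σ′ , 0)
          off-i : ∀ {k} → k ≢ i → lookup s′ k ≡ lookup (tuple σ) k
          off-i k≢i = lookup∘update′ k≢i (tuple σ) (σ′ , 0)
          unborn : ∀ {k} → k ≢ i → lookup s′ i ≢ lookup s′ k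
          unborn {k} k≢i eq with cong proj₁ (trans (sym at-i) (trans eq (off-i k≢i))) | birth σ k
          ... | eq′ | inj₁ eq″ = ℕ.<-irrefl (sym (cong length (trans eq′ eq″))) (ℕ.n<1+n (length σ))
          ... | eq′ | inj₂ lt  = ℕ.<-asym (subst (λ β → length β ℕ.< length σ) (sym eq′) lt) (ℕ.n<1+n (length σ))
          fresh : Dec (k ≡ i) → Dec (l ≡ i) → Iff (lookup s′ k ≡ lookup s′ l) (P σ′ (k ≐ l))
          fresh (yes refl) (yes refl) = (λ _ → ≐-refl σ′ i) , (λ _ → refl)
          fresh (yes refl) (no l≢i)   = (λ eq → ⊥-elim (unborn l≢i eq)) ,
                                        (λ p → ⊥-elim (new (l , l≢i ∘ sym , p)))
          fresh (no k≢i)   (yes refl) = (λ eq → ⊥-elim (unborn k≢i (sym eq))) ,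
                                        (λ p → ⊥-elim (new (k , k≢i ∘ sym , ≐-sym σ′ p)))
          fresh (no k≢i)   (no l≢i)   =
            (λ eq → proj₂ inv (proj₁ below (trans (sym (off-i k≢i)) (trans eq (off-i l≢i))))) ,
            (λ p → trans (off-i k≢i) (trans (proj₂ below (proj₁ inv p)) (sym (off-i l≢i))))
            where
            inv   = P-invariant i φ σ {k ≐ l} (≐-invariant k≢i l≢i)
            below = tuple-≡ σ k l

      -- A description of the tuple t and of its type Q as a substitution instance of a node such
      -- that t contains an element born at the node.
      record Reduced (t : Vec Point n) (Q : Form → Set) : Set₁ where
        field
          node   : Node
          via    : Subst
          tuple≡ : t ≡ tuple node ⊙ τ via
          type⇔  : ∀ φ → Iff (Q φ) (P node (form via φ))
          spot   : Fin n
          born   : proj₁ (lookup t spot) ≡ node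

      open Reduced

      transport : ∀ {t t′ : Vec Point n} {Q Q′ : Form → Set} → t ≡ t′ →
                  (∀ φ → Iff (Q φ) (Q′ φ)) → Reduced t′ Q′ → Reduced t Q
      transport refl Q⇔Q′ r = record
        { node = node r ; via = via r ; tuple≡ = tuple≡ r ; spot = spot r ; born = born r
        ; type⇔ = λ φ → proj₁ (type⇔ r φ) ∘ proj₁ (Q⇔Q′ φ) , proj₂ (Q⇔Q′ φ) ∘ proj₂ (type⇔ r φ)
        }

      -- If τ misses the value i, then s ∘ τ does not depend on the i-th coordinate of s.
      invariant-subst : ∀ {i} w → (∀ k → lookup (τ w) k ≢ i) → ∀ φ → Invariant i (form w φ)
      invariant-subst w miss φ 𝔐 s t s∼t p =
        complete w 𝔐 t (shift w 𝔐 s) (vec-ext λ k → trans (lookup-⊙ (proj₁ s) (τ w) k)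
          (trans (s∼t _ (miss k)) (sym (lookup-⊙ (proj₁ t) (τ w) k)))) φ
          (sound w 𝔐 s (shift w 𝔐 s) refl φ p)

      -- Walk towards the root until the element born at the node occurs in the tuple.
      reduce : ∀ σ w → Reduced (tuple σ ⊙ τ w) (P σ ∘ form w)
      reduce [] w = record
        { node = [] ; via = w ; tuple≡ = refl ; type⇔ = λ _ → id , id
        ; spot = k₀
        ; born = trans (cong proj₁ (lookup-⊙ (tuple []) (τ w) k₀)) (root-born (birth [] (lookup (τ w) k₀))) }
        where
        k₀ : Fin n
        k₀ = fromℕ< 1<n
        root-born : ∀ {β : Node} → β ≡ [] ⊎ length β ℕ.< 0 → β ≡ []
        root-born (inj₁ eq) = eq
      reduce (rename π ∷ σ) w = transport
        (⊙-assoc (tuple σ) (τ (there (renamingBy C {Rel = Rel} π))) (τ w)) (λ _ → id , id)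
        (reduce σ (there (renamingBy C π) ∙ w))
      reduce (witness i φ ∷ σ) w = placed em₀ refl
        where
        σ′ : Node
        σ′ = witness i φ ∷ σ
        placed : ∀ d → place i σ′ d (tuple σ) ≡ tuple σ′ →
                 Reduced (place i σ′ d (tuple σ) ⊙ τ w) (P σ′ ∘ form w)
        placed (yes (k , i≢k , i≐k)) _ = transport (⊙-assoc (tuple σ) [ i ∣ k ] (τ w))
          (λ ψ → P-old i φ σ i≢k i≐k (form w ψ)) (reduce σ (replace i k i≢k ∙ w))
        placed (no new) eq with em₀ {∃[ k ] lookup (τ w) k ≡ i} | reduce σ w
        ... | no miss | r = transport
          (vec-ext λ k → trans (lookup-⊙ (tuple σ [ i ]≔ (σ′ , 0)) (τ w) k) (trans
            (lookup∘update′ (λ eq → miss (k , eq)) (tuple σ) (σ′ , 0)) (sym (lookup-⊙ (tuple σ) (τ w) k))))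
          (λ ψ → P-invariant i φ σ {form w ψ} (invariant-subst w (λ k eq → miss (k , eq)) ψ)) r
        ... | yes (k , τk≡i) | _ = record
          { node = σ′ ; via = w ; tuple≡ = cong (_⊙ τ w) eq ; type⇔ = λ _ → id , id ; spot = k
          ; born = cong proj₁ (trans (lookup-⊙ (tuple σ [ i ]≔ (σ′ , 0)) (τ w) k)
              (trans (cong (lookup (tuple σ [ i ]≔ (σ′ , 0))) τk≡i) (lookup∘update i (tuple σ) (σ′ , 0)))) }

      -- If s ∘ τ = s ∘ τ′, the type knows it: it contains the equations between the entries.
      same-node : ∀ σ w v → tuple σ ⊙ τ w ≡ tuple σ ⊙ τ v → ∀ φ → P σ (form w φ) → P σ (form v φ)
      same-node σ w v eq φ p = entail (ty σ) {χ = form v φ} (p ∷ tabulate⁺ equal)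
        λ { 𝔐 _ s (q ∷ eqs) → complete v 𝔐 s (shift w 𝔐 s)
              (vec-ext λ k → trans (lookup-⊙ (proj₁ s) (τ w) k)
                (trans (tabulate⁻ eqs k) (sym (lookup-⊙ (proj₁ s) (τ v) k)))) φ
              (sound w 𝔐 s (shift w 𝔐 s) refl φ q) }
        where
        equal : ∀ k → P σ (lookup (τ w) k ≐ lookup (τ v) k)
        equal k = proj₁ (tuple-≡ σ _ _) (trans (sym (lookup-⊙ (tuple σ) (τ w) k))
          (trans (cong (λ t → lookup t k) eq) (lookup-⊙ (tuple σ) (τ v) k)))

      born-in : ∀ {t σ} (w : Subst {C} {n} {Rel}) k → t ≡ tuple σ ⊙ τ w →
                proj₁ (lookup t k) ≡ σ ⊎ length (proj₁ (lookup t k)) ℕ.< length σ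
      born-in {σ = σ} w k eq = subst (λ e → proj₁ e ≡ σ ⊎ length (proj₁ e) ℕ.< length σ)
        (sym (trans (cong (λ s → lookup s k) eq) (lookup-⊙ (tuple σ) (τ w) k))) (birth σ (lookup (τ w) k))

      -- An element of t born at one node occurs in the tuple of the other, which is therefore
      -- at least as long; when the lengths agree, the nodes do.
      reduced-node-unique : ∀ {t Q Q′} (r : Reduced t Q) (r′ : Reduced t Q′) → node r ≡ node r′
      reduced-node-unique {t} r r′ =
        decide (located r r′) (located r′ r)
        where
        located : ∀ {Q Q′} (r : Reduced t Q) (r′ : Reduced t Q′) →
                  node r ≡ node r′ ⊎ length (node r) ℕ.< length (node r′)
        located r r′ = subst (λ β → β ≡ node r′ ⊎ length β ℕ.< length (node r′)) (born r)
          (born-in (via r′) (spot r) (tuple≡ r′))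
        decide : ∀ {σ σ′ : Node} → σ ≡ σ′ ⊎ length σ ℕ.< length σ′ → σ′ ≡ σ ⊎ length σ′ ℕ.< length σ → σ ≡ σ′
        decide (inj₁ eq) _         = eq
        decide (inj₂ _)  (inj₁ eq) = sym eq
        decide (inj₂ p)  (inj₂ q)  = ⊥-elim (ℕ.<-asym p q)

      reduced-agree : ∀ {t Q Q′} → Reduced t Q → Reduced t Q′ → ∀ φ → Q φ → Q′ φ
      reduced-agree r r′ φ q with refl ← reduced-node-unique r r′ =
        proj₂ (type⇔ r′ φ) (same-node (node r) (via r) (via r′)
          (trans (sym (tuple≡ r)) (tuple≡ r′)) φ (proj₁ (type⇔ r φ) q))

      -- The type of a tuple does not depend on its presentation.
      type-unique : ∀ σ σ′ w v → tuple σ ⊙ τ w ≡ tuple σ′ ⊙ τ v → ∀ φ → P σ (form w φ) → P σ′ (form v φ)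
      type-unique σ σ′ w v eq =
        reduced-agree (reduce σ w) (transport eq (λ _ → id , id) (reduce σ′ v))

      -- Replacing xⱼ by another variable makes the two tuples equal and does not affect ∃xⱼψ.
      ∃-coherent : ∀ σ σ′ j {ψ} → tuple σ ∼[ j ] tuple σ′ → P σ (∃′ j ψ) → P σ′ (∃′ j ψ)
      ∃-coherent σ σ′ j {ψ} σ∼σ′ p = entail (ty σ′) {χ = ∃′ j ψ}
        (type-unique σ σ′ w w eq (∃′ j ψ)
          (entail (ty σ) {χ = form w (∃′ j ψ)} (p ∷ [])
            λ { 𝔐 _ s ((t , t∼s , q) ∷ []) → complete w 𝔐 s (shift w 𝔐 s) refl (∃′ j ψ)
              (t , (λ l l≢j → trans (t∼s l l≢j) (sym ([∣]-∼ (proj₁ s) j k l l≢j))) , q) }) ∷ [])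
        λ { 𝔐 _ s (q ∷ []) → unshift 𝔐 s (sound w 𝔐 s (shift w 𝔐 s) refl (∃′ j ψ) q) }
        where
        k : Fin n
        k = proj₁ (another 1<n j)
        j≢k : j ≢ k
        j≢k = proj₂ (another 1<n j)
        w : Subst
        w = replace j k j≢k
        eq : tuple σ ⊙ [ j ∣ k ] ≡ tuple σ′ ⊙ [ j ∣ k ]
        eq = replaced {s = tuple σ′} j≢k
          (λ l l≢j → trans ([∣]-∼ (tuple σ) j k l l≢j) (σ∼σ′ l l≢j)) ([∣]-≡ (tuple σ) j≢k)
        unshift : ∀ 𝔐 s → Sat 𝔐 (shift w 𝔐 s) (∃′ j ψ) → Sat 𝔐 s (∃′ j ψ)
        unshift 𝔐 s (t , t∼s′ , q) = t , (λ l l≢j → trans (t∼s′ l l≢j) ([∣]-∼ (proj₁ s) j k l l≢j)) , q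

      -- The base of the model consists of the points that occur in some tuple.
      Used : Point → Set
      Used e = ∃[ σ ] ∃[ k ] lookup (tuple σ) k ≡ e

      Element : Set
      Element = Σ[ e ∈ Point ] True (em₀ {Used e})

      element-≡ : ∀ {e f : Element} → proj₁ e ≡ proj₁ f → e ≡ f
      element-≡ {e , _} {_ , _} refl = cong (e ,_) (T-irrelevant _ _)

      entry : Node → Fin n → Element
      entry σ k = lookup (tuple σ) k , fromWitness (σ , k , refl)

      -- The tuple at a node, with entries in the base.
      tuple⁺ : Node → Vec Element n
      tuple⁺ σ = tabulate (entry σ)

      lookup-tuple⁺ : ∀ σ k → lookup (tuple⁺ σ) k ≡ entry σ k
      lookup-tuple⁺ σ = lookup∘tabulate (entry σ)

      -- Equality of entries is the same for tuple⁺ as for tuple, and likewise the action of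
      -- transformations.
      ≡⁻ : ∀ {σ k σ′ k′} → lookup (tuple⁺ σ) k ≡ lookup (tuple⁺ σ′) k′ →
           lookup (tuple σ) k ≡ lookup (tuple σ′) k′
      ≡⁻ {σ} {k} {σ′} {k′} eq = cong proj₁ (trans (sym (lookup-tuple⁺ σ k)) (trans eq (lookup-tuple⁺ σ′ k′)))

      ≡⁺ : ∀ {σ k σ′ k′} → lookup (tuple σ) k ≡ lookup (tuple σ′) k′ →
           lookup (tuple⁺ σ) k ≡ lookup (tuple⁺ σ′) k′
      ≡⁺ {σ} {k} {σ′} {k′} eq = trans (lookup-tuple⁺ σ k) (trans (element-≡ eq) (sym (lookup-tuple⁺ σ′ k′)))

      ⊙⁺ : ∀ {σ σ′ ρ} → tuple σ′ ≡ tuple σ ⊙ ρ → tuple⁺ σ′ ≡ tuple⁺ σ ⊙ ρ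
      ⊙⁺ {σ} {σ′} {ρ} eq = vec-ext λ k → trans
        (≡⁺ {σ′} {k} {σ} {lookup ρ k} (trans (cong (λ t → lookup t k) eq) (lookup-⊙ (tuple σ) ρ k)))
        (sym (lookup-⊙ (tuple⁺ σ) ρ k))

      ⊙⁻ : ∀ {σ σ′ ρ} → tuple⁺ σ′ ≡ tuple⁺ σ ⊙ ρ → tuple σ′ ≡ tuple σ ⊙ ρ
      ⊙⁻ {σ} {σ′} {ρ} eq = vec-ext λ k → trans
        (≡⁻ {σ′} {k} {σ} {lookup ρ k} (trans (cong (λ t → lookup t k) eq) (lookup-⊙ (tuple⁺ σ) ρ k)))
        (sym (lookup-⊙ (tuple σ) ρ k))

      Unit : Pred (Vec Element n) 0ℓ
      Unit s = ∃[ σ ] tuple⁺ σ ≡ s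

      -- The demand for a witness of xᵢ = xⱼ leads to the tuple s ∘ [ i ∣ j ].
      unit-replace : ∀ i j s → Unit s → Unit (s ⊙ [ i ∣ j ])
      unit-replace i j _ (σ , refl) with i ≟ j
      ... | yes refl = σ , sym (⊙[i∣i] (tuple⁺ σ) i)
      ... | no i≢j   = σ′ , ⊙⁺ {σ} {σ′} (replaced {s = tuple σ} i≢j (tuple-∼ i (i ≐ j) σ)
          (proj₂ (tuple-≡ σ′ i j) i≐j))
        where
        σ′ : Node
        σ′ = witness i (i ≐ j) ∷ σ
        i≐j : P σ′ (i ≐ j)
        i≐j = entail (ty σ′) {χ = i ≐ j} (P-witness i (i ≐ j) σ ∷ []) λ { 𝔐 _ s (f ∷ []) →
          f (shift (replace i j i≢j) 𝔐 s , [∣]-∼ (proj₁ s) i j , [∣]-≡ (proj₁ s) i≢j) }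

      unit-⊙ : C ≡ 𝔾 → ∀ ρ s → Unit s → Unit (s ⊙ ρ)
      unit-⊙ C≡𝔾 = transf-induction (λ ρ → ∀ s → Unit s → Unit (s ⊙ ρ))
        (λ { π ρ inv _ (σ , refl) → (rename π ∷ σ) ,
             ⊙⁺ {σ} {rename π ∷ σ} (cong (tuple σ ⊙_) (renamingBy-τ C≡𝔾 inv)) })
        (λ ρ a b ih s Us → subst Unit (⊙-assoc s ρ [ a ∣ b ]) (unit-replace a b _ (ih s Us)))

      -- The unit consists of the tuples of the tree, and R holds of a tuple iff its type
      -- contains R(x₀,…,xₙ₋₁).
      𝔐ω : Model C n Rel
      𝔐ω = record
        { Base     = Element
        ; nonempty = entry [] (fromℕ< 1<n)
        ; V        = Unit
        ; isUnit   = toUnit C unit-replace unit-⊙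
        ; covered  = λ (e , used) → let (σ , k , eq) = toWitness used in
                       tuple⁺ σ , (σ , refl) , k , trans (lookup-tuple⁺ σ k) (element-≡ eq)
        ; interp   = λ R s → ∃[ σ ] (tuple⁺ σ ≡ s × P σ (rel R (idArgs C)))
        ; interp⊆V = λ { R s (σ , eq , _) → σ , eq }
        }

      Element-countable : Countable Element
      Element-countable = ↣-countable proj₁ element-≡ (×-countable Node-countable ℕ-countable)

      -- A formula holds at the tuple of σ iff it belongs to the type at σ.
      truth : ∀ φ σ Uσ → Iff (Sat 𝔐ω (tuple⁺ σ , Uσ) φ) (P σ φ)
      truth (rel R a) σ Uσ = to , from
        where
        w : Subst
        w = proj₁ (argSubst C a)
        select≡ : ∀ {M : Set} (s : Vec M n) → select C a s ≡ s ⊙ τ w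
        select≡ = proj₂ (argSubst C a)
        atom⇔ : Iff (P σ (form w (rel R (idArgs C)))) (P σ (rel R a))
        atom⇔ =
          (λ p → entail (ty σ) {χ = rel R a} (p ∷ []) λ { 𝔐 _ s (q ∷ []) → subst (Model.interp 𝔐 R)
            (trans (select-idArgs C _) (sym (select≡ (proj₁ s))))
            (sound w 𝔐 s (shift w 𝔐 s) refl (rel R (idArgs C)) q) }) ,
          (λ p → entail (ty σ) {χ = form w (rel R (idArgs C))} (p ∷ []) λ { 𝔐 _ s (q ∷ []) →
            complete w 𝔐 s (shift w 𝔐 s) refl (rel R (idArgs C)) (subst (Model.interp 𝔐 R)
              (sym (trans (select-idArgs C _) (sym (select≡ (proj₁ s))))) q) })
        same : ∀ {σ′} → tuple⁺ σ′ ≡ tuple⁺ σ ⊙ τ w → tuple σ′ ⊙ allFin n ≡ tuple σ ⊙ τ w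
        same {σ′} eq = trans (⊙-allFin (tuple σ′)) (⊙⁻ {σ} {σ′} eq)
        to : Sat 𝔐ω (tuple⁺ σ , Uσ) (rel R a) → P σ (rel R a)
        to (σ′ , eq , p) = proj₁ atom⇔ (type-unique σ′ σ idSubst w
          (same (trans eq (select≡ (tuple⁺ σ)))) (rel R (idArgs C)) p)
        from : P σ (rel R a) → Sat 𝔐ω (tuple⁺ σ , Uσ) (rel R a)
        from p = let (σ′ , eq) = keep w (Model.isUnit 𝔐ω) Uσ in
          σ′ , trans eq (sym (select≡ (tuple⁺ σ))) ,
          type-unique σ σ′ w idSubst (sym (same eq)) (rel R (idArgs C)) (proj₂ atom⇔ p)
      truth (k ≐ l) σ Uσ =
        proj₁ (tuple-≡ σ k l) ∘ ≡⁻ {σ} {k} {σ} {l} ,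
        ≡⁺ {σ} {k} {σ} {l} ∘ proj₂ (tuple-≡ σ k l)
      truth (¬′ φ) σ Uσ = let ih = truth φ σ Uσ in
        (λ ¬q → ¬-intro (ty σ) (¬q ∘ proj₂ ih)) , (λ p q → consistent (ty σ) (proj₁ ih q) p)
      truth (φ ∧′ ψ) σ Uσ = let ih₁ = truth φ σ Uσ ; ih₂ = truth ψ σ Uσ in
        (λ (q , r) → ∧-closed (ty σ) (proj₁ ih₁ q) (proj₁ ih₂ r)) ,
        (λ p → proj₂ ih₁ (entail (ty σ) {χ = φ} (p ∷ []) λ { _ _ _ ((q , _) ∷ []) → q }) ,
               proj₂ ih₂ (entail (ty σ) {χ = ψ} (p ∷ []) λ { _ _ _ ((_ , q) ∷ []) → q }))
      truth (φ ∨′ ψ) σ Uσ = to , from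
        where
        ih₁ = truth φ σ Uσ
        ih₂ = truth ψ σ Uσ
        to : Sat 𝔐ω (tuple⁺ σ , Uσ) (φ ∨′ ψ) → P σ (φ ∨′ ψ)
        to (inj₁ q) = entail (ty σ) {χ = φ ∨′ ψ} (proj₁ ih₁ q ∷ []) λ { _ _ _ (r ∷ []) → inj₁ r }
        to (inj₂ q) = entail (ty σ) {χ = φ ∨′ ψ} (proj₁ ih₂ q ∷ []) λ { _ _ _ (r ∷ []) → inj₂ r }
        from : P σ (φ ∨′ ψ) → Sat 𝔐ω (tuple⁺ σ , Uσ) (φ ∨′ ψ)
        from p with max (ty σ) φ
        ... | inj₁ q  = inj₁ (proj₂ ih₁ q)
        ... | inj₂ ¬q = inj₂ (proj₂ ih₂ (entail (ty σ) {χ = ψ} (p ∷ ¬q ∷ [])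
          λ { _ _ _ (inj₁ r ∷ ¬r ∷ []) → ⊥-elim (¬r r) ; _ _ _ (inj₂ r ∷ _ ∷ []) → r }))
      truth (φ ⇒′ ψ) σ Uσ = to , from
        where
        ih₁ = truth φ σ Uσ
        ih₂ = truth ψ σ Uσ
        to : Sat 𝔐ω (tuple⁺ σ , Uσ) (φ ⇒′ ψ) → P σ (φ ⇒′ ψ)
        to f with max (ty σ) φ
        ... | inj₁ p  = entail (ty σ) {χ = φ ⇒′ ψ} (proj₁ ih₂ (f (proj₂ ih₁ p)) ∷ []) λ { _ _ _ (q ∷ []) _ → q }
        ... | inj₂ ¬p = entail (ty σ) {χ = φ ⇒′ ψ} (¬p ∷ []) λ { _ _ _ (¬q ∷ []) q → ⊥-elim (¬q q) }
        from : P σ (φ ⇒′ ψ) → Sat 𝔐ω (tuple⁺ σ , Uσ) (φ ⇒′ ψ)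
        from p q = proj₂ ih₂ (entail (ty σ) {χ = ψ} (p ∷ proj₁ ih₁ q ∷ []) λ { _ _ _ (f ∷ r ∷ []) → f r })
      truth (∃′ i φ) σ Uσ = to , from
        where
        to : Sat 𝔐ω (tuple⁺ σ , Uσ) (∃′ i φ) → P σ (∃′ i φ)
        to ((_ , σ′ , refl) , σ′∼σ , q) = ∃-coherent σ′ σ i {φ} (λ j j≢i → ≡⁻ {σ′} {j} {σ} {j} (σ′∼σ j j≢i))
          (entail (ty σ′) {χ = ∃′ i φ} (proj₁ (truth φ σ′ (σ′ , refl)) q ∷ [])
            λ { 𝔐 _ s (r ∷ []) → s , (λ _ _ → refl) , r })
        from : P σ (∃′ i φ) → Sat 𝔐ω (tuple⁺ σ , Uσ) (∃′ i φ)
        from p = (tuple⁺ σ′ , σ′ , refl) , (λ j j≢i → ≡⁺ {σ′} {j} {σ} {j} (tuple-∼ i φ σ j j≢i)) ,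
          proj₂ (truth φ σ′ (σ′ , refl)) (entail (ty σ′) {χ = φ}
            (P-witness i φ σ ∷ proj₂ (P-invariant i φ σ {∃′ i φ} ∃-invariant) p ∷ [])
            λ { _ _ _ (f ∷ q ∷ []) → f q })
          where
          σ′ : Node
          σ′ = witness i φ ∷ σ
          ∃-invariant : Invariant i (∃′ i φ)
          ∃-invariant 𝔐 s t s∼t (u , u∼s , q) = u , (λ k k≢i → trans (u∼s k k≢i) (s∼t k k≢i)) , q

      𝔐ω-models : IsModelOf T 𝔐ω
      𝔐ω-models (_ , σ , refl) φ Tφ = proj₂ (truth φ σ (σ , refl))
        (entail (ty σ) {χ = φ} [] λ _ mod s _ → mod s φ Tφ)

      𝔐ω-omits : ∀ i → Omits 𝔐ω (Γ i)
      𝔐ω-omits i ((_ , σ , refl) , realizes) =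
        let (γ , Γγ , p¬γ) = omits (proj₂ (types σ)) i [] in
        consistent (ty σ) (proj₁ (truth γ σ (σ , refl)) (realizes γ Γγ)) p¬γ

    omittingModel : ∀ {φ} → Satisfiable φ →
      Σ[ 𝔐 ∈ Model C n Rel ] (IsModelOf T 𝔐 × Countable (Model.Base 𝔐) × (∀ i → Omits 𝔐 (Γ i)))
    omittingModel {φ} satφ = 𝔐ω , 𝔐ω-models , Element-countable , 𝔐ω-omits
      where open TypeTree {φ} satφ

-- Omitting types over a guessable index set.
module Main (em : ExcludedMiddle (ℓsuc 0ℓ)) where
  open Classical em
  open Coding
  open Guessing em using (Guess; Guess-countable)
  open RealLine em using (Guess-noncovering)
  open Types em
  open Construction em using (omittingModel)
  open import Data.Nat.Base using (_<_)
  open import Data.Fin.Base using (fromℕ<)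

  consistent⇒satisfiable : ∀ {C n} {Rel : Set} {T : Pred (Formula C n Rel) 0ℓ} (0<n : 0 < n) →
                           Consistent T → Satisfiable T (fromℕ< 0<n ≐ fromℕ< 0<n)
  consistent⇒satisfiable 0<n con = byContradiction₁ λ none → con
    (fromℕ< 0<n ≐ fromℕ< 0<n , (λ _ _ _ → refl) , λ 𝔐 mod s _ → none (𝔐 , mod , s , refl))

  omitting : ∀ {C n} → 1 < n → ∀ {Rel : Set} → Countable Rel →
             (T : Pred (Formula C n Rel) 0ℓ) → Consistent T →
             ∀ {I} → Guess I → (Γ : I → Pred (Formula C n Rel) 0ℓ) → (∀ i → NonPrincipal T (Γ i)) →
             ∃[ 𝔐 ] (IsModelOf T 𝔐 × Countable (Model.Base 𝔐) × (∀ i → Omits 𝔐 (Γ i)))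
  omitting 1<n cRel T con G Γ nonPr =
    omittingModel T 1<n cRel G Γ (λ i → nonPrincipal⇒avoidable T {Γ i} (nonPr i))
      {fromℕ< 0<n ≐ fromℕ< 0<n} (consistent⇒satisfiable 0<n con)
    where
    open import Data.Nat.Properties using (<-trans; n<1+n)
    0<n = <-trans (n<1+n 0) 1<n

open import Level using (suc)
open import Data.Nat.Base using (ℕ; _<_)

theorem5p33 : ExcludedMiddle (suc 0ℓ) →
    ∀ (C : Class) (n : ℕ) → 1 < n →
    OmittingTypesTheorem C n ×
    (∀ (κ : Set) → IsCovK κ →
    ∀ (Rel : Set) → Countable Rel →
    ∀ (T : Pred (Formula C n Rel) 0ℓ) → Consistent T →
    ∀ (I : Set) → I ≺ κ →
    ∀ (Γ : I → Pred (Formula C n Rel) 0ℓ) → (∀ i → NonPrincipal T (Γ i)) →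
    ∃[ 𝔐 ] (IsModelOf T 𝔐 × Countable (Model.Base 𝔐) × (∀ i → Omits 𝔐 (Γ i))))
theorem5p33 em C n 1<n =
  (λ Rel cRel T con I cI Γ nonPr →
    let (𝔐 , models , _ , omits) = omitting 1<n cRel T con (Guess-countable cI) Γ nonPr
    in 𝔐 , models , omits) ,
  (λ κ (_ , least) Rel cRel T con I (_ , κ≰I) Γ nonPr →
    omitting 1<n cRel T con (Guess-noncovering (λ covers → κ≰I (least I covers))) Γ nonPr)
  where
  open Main em
  open Guessing em using (Guess-countable)
  open RealLine em using (Guess-noncovering)
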